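{- Let $i\ge 3$ and $k\ge 3$ be integers. Then: (a) $n_2(F_i,F_{i+2},F_{i+k})=\tfrac12\bigl(5F_iF_{i+2}-F_i-F_{i+2}+1\bigr)$ whenever $k\ge i+3$; (b) $n_2(F_i,F_{i+2},F_{2i+2})=\tfrac12\bigl((7F_{i+2}-6F_i-1)F_i-F_{i+2}+1\bigr)$; (c) $n_2(F_i,F_{i+2},F_{2i+1})=\tfrac12\bigl((7F_{i+2}-8F_i-1)F_i-F_{i+2}+1\bigr)$; (d) $n_2(F_i,F_{i+2},F_{2i})=\tfrac12\bigl(3F_iF_{i+2}-F_i-F_{i+2}+1\bigr)$; (e) $n_2(F_i,F_{i+2},F_{2i-1})=\tfrac12\bigl((170F_i-1)F_i+(24F_{i+2}-125F_i-1)F_{i+2}+1\bigr)$; (f) if $r=\lfloor (F_i-1)/F_k\rfloor\ge 2$ (equivalently $k\le i-2$), then $$n_2(F_i,F_{i+2},F_{i+k})=\tfrac12\bigl((F_i+4F_k-1)F_{i+2}-F_i+1\bigr)-\tfrac12\bigl(2rF_i-(r+3)(r-2)F_k\bigr)F_{k-2}.$$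
   Context: Fibonacci numbers: $F_0=0$, $F_1=1$, $F_n=F_{n-1}+F_{n-2}$. For positive integers $a_1,\dots,a_l$ with $\gcd(a_1,\dots,a_l)=1$ and an integer $n$, let $d(n;a_1,\dots,a_l)$ be the number of tuples $(x_1,\dots,x_l)$ of nonnegative integers with $a_1x_1+\dots+a_lx_l=n$. For a nonnegative integer $p$, the $p$-Sylvester number $n_p(a_1,\dots,a_l)$ is the number of nonnegative integers $n$ with $d(n;a_1,\dots,a_l)\le p$. -}

module Defs where

open import Data.Fin.Base using (Fin)
open import Data.Fin.Permutation using (↔⇒≡)
open import Data.Integer.Base using (+_)
open import Data.List.Base as List using (List; length; filter; upTo; cartesianProductWith)
open import Data.List.Membership.Propositional using (_∈_)
open import Data.List.Membership.Propositional.Properties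
  using (∈-cartesianProductWith⁺; ∈-filter⁺; ∈-filter⁻; ∈-upTo⁺)
open import Data.List.Relation.Unary.Any using (here)
open import Data.List.Relation.Unary.Unique.Propositional using (Unique)
import Data.List.Relation.Unary.Unique.Propositional.Properties as Unique
import Data.List.Relation.Unary.AllPairs as AllPairs
import Data.List.Relation.Unary.All as ListAll
open import Data.Nat.Base
open import Data.Nat.GCD using (gcd)
open import Data.Nat.Properties
open import Data.Product.Base using (∃; _×_; _,_; proj₂)
open import Data.Rational.Base as ℚ using (ℚ)
open import Data.Vec.Base using (Vec; []; _∷_; zipWith; sum; foldr′)
open import Data.Vec.Properties using (∷-injective)
open import Data.Vec.Relation.Unary.All using (All; []; _∷_)
open import Function.Bundles using (_↔_)
open import Function.Construct.Composition using (_↔-∘_)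
open import Function.Construct.Symmetry using (↔-sym)
open import Relation.Binary.PropositionalEquality

F : ℕ → ℕ
F 0             = 0
F 1             = 1
F (suc (suc n)) = F (suc n) + F n

F-nonZero : ∀ {k} → 1 ≤ k → NonZero (F k)
F-nonZero 1≤k = >-nonZero (F-pos 1≤k)
  where
  F-pos : ∀ {k} → 1 ≤ k → 0 < F k
  F-pos {1}           _ = z<s
  F-pos {suc (suc k)} _ = ≤-trans (F-pos {suc k} (s≤s z≤n)) (m≤m+n (F (suc k)) (F k))

infix 8 _·_

_·_ : ∀ {l} → Vec ℕ l → Vec ℕ l → ℕ
as · xs = sum (zipWith _*_ as xs)

tuples≤ : ∀ l → ℕ → List (Vec ℕ l)
tuples≤ zero    n = List.[ [] ]
tuples≤ (suc l) n = cartesianProductWith _∷_ (upTo (suc n)) (tuples≤ l n)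

-- When all aᵢ are positive, every solution of a₁x₁ + ⋯ + aₗxₗ = n has entries
-- at most n, so searching these tuples loses nothing (∈-solutions below).
solutions : ∀ {l} → ℕ → Vec ℕ l → List (Vec ℕ l)
solutions {l} n as = filter (λ xs → as · xs ≟ n) (tuples≤ l n)

d : ∀ {l} → ℕ → Vec ℕ l → ℕ
d n as = length (solutions n as)

solutions-sound : ∀ {l} n (as : Vec ℕ l) {xs} → xs ∈ solutions n as → as · xs ≡ n
solutions-sound {l} n as xs∈ = proj₂ (∈-filter⁻ (λ xs → as · xs ≟ n) {xs = tuples≤ l n} xs∈)

∈-solutions : ∀ {l n} {as xs : Vec ℕ l} → All NonZero as → as · xs ≡ n → xs ∈ solutions n as
∈-solutions {l} {n} {as} pos eq =
  ∈-filter⁺ (λ xs → as · xs ≟ n) (∈-tuples≤ pos (≤-reflexive eq)) eq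
  where
  ∈-tuples≤ : ∀ {l} {as xs : Vec ℕ l} → All NonZero as → as · xs ≤ n → xs ∈ tuples≤ l n
  ∈-tuples≤ {as = []}     {[]}     _          _  = here refl
  ∈-tuples≤ {as = a ∷ as} {x ∷ xs} (a≢0 ∷ pos) le =
    ∈-cartesianProductWith⁺ _∷_
      (∈-upTo⁺ (s≤s (≤-trans (m≤n*m x a {{a≢0}}) (m+n≤o⇒m≤o (a * x) le))))
      (∈-tuples≤ pos (m+n≤o⇒n≤o (a * x) le))

solutions-unique : ∀ {l} n (as : Vec ℕ l) → Unique (solutions n as)
solutions-unique {l} n as = Unique.filter⁺ (λ xs → as · xs ≟ n) (tuples≤-unique l)
  where
  tuples≤-unique : ∀ l → Unique (tuples≤ l n)
  tuples≤-unique zero    = ListAll.[] AllPairs.∷ AllPairs.[]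
  tuples≤-unique (suc l) =
    Unique.cartesianProductWith⁺ _∷_ ∷-injective (Unique.upTo⁺ (suc n)) (tuples≤-unique l)

-- m is the p-Sylvester number nₚ(a₁,…,aₗ). It is a relation because the set being
-- counted is only known to be finite through gcd(a₁,…,aₗ) = 1. As d n as ≤ p is a
-- proposition, the pairs in `count` correspond exactly to the numbers n.
record IsSylvesterNumber {l} (p : ℕ) (as : Vec ℕ l) (m : ℕ) : Set where
  field
    positive : All NonZero as
    coprime  : foldr′ gcd 0 as ≡ 1
    count    : Fin m ↔ ∃ λ n → d n as ≤ p

IsSylvesterNumber-unique : ∀ {l p m m′} {as : Vec ℕ l} →
  IsSylvesterNumber p as m → IsSylvesterNumber p as m′ → m ≡ m′
IsSylvesterNumber-unique s t =
  ↔⇒≡ (↔-sym (count t) ↔-∘ count s)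
  where open IsSylvesterNumber

infix 4 n[_]_≐_

n[_]_≐_ : ∀ {l} → ℕ → Vec ℕ l → ℚ → Set
n[ p ] as ≐ q = ∃ λ m → IsSylvesterNumber p as m × (+ m) ℚ./ 1 ≡ q

{-# OPTIONS --safe #-}

-- Write A = F i, B = F (i + 2), G = F k, H = F (k − 2), so that F (i + k) + A H = B G.
-- Substituting s = y + G z = t + u A with 0 ≤ t < A, the solutions (x , y , z) of
-- A x + B y + F (i + k) z = n with n ≡ B t (mod A) correspond to the points (u , z) with
-- G z ≤ t + u A and ⌊B t / A⌋ + B u − H z ≤ ⌊n / A⌋. Hence at most two solutions exist exactly
-- when ⌊n / A⌋ lies below ⌊B t / A⌋ plus the third smallest value of B u − H z, and the
-- 2-Sylvester number is the sum of these thresholds over t. Call the points with first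
-- coordinate u row u. Since 5 A ≤ 2 B and 2 H ≤ G, for u ≤ 3 the values in row u are at most B u
-- and those in later rows at least B u, so the third smallest value is found by listing the rows
-- in order; it depends only on the lengths of rows 0, 1, 2.
module Submission where

open import Defs

-- With C = F (i + k), the identity C = B G - A H turns A x + B y + C z into A (x - H z) + B (y + G
-- z). This is why s is the natural variable and why B u - H z is the cost of a point. The cost is
-- linear in the point, so the sum of the thresholds needs only the sums of the two coordinates over
-- t; the sum of ⌊B t / A⌋ contributes Sylvester's (A - 1)(B - 1) / 2. Row u has 1 + ⌊(t + u A) / G⌋
-- points, so the cases differ by the position of G relative to A: 3 A ≤ G in (a), 2 A ≤ G ≤ 3 A in
-- (b), A ≤ G ≤ 2 A in (c), A = G in (d), 3 G ≤ 2 A ≤ 4 G in (e), 2 G ≤ A in (f). The comparison of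
-- rows rests on 5 A H ≤ B G, the product of the two inequalities above. Counting is done in ℕ with
-- subtracted terms moved across the equation; integers and rationals enter only to match the closed
-- forms.

module Proof where

  open import Algebra.Properties.CommutativeMonoid.Sum as Sum using ()
  open import Data.Fin.Base as Fin using (Fin; toℕ; fromℕ<; punchOut)
  open import Data.Fin.Permutation using (reverse)
  open import Data.Fin.Properties as Fin
    using (toℕ-injective; toℕ<n; toℕ-fromℕ<; opposite-prop; any?; punchOut-injective; injective⇒≤; +↔⊎)
  import Data.Integer.Base as ℤ
  import Data.Integer.Properties as ℤ
  open import Data.Integer.Tactic.RingSolver renaming (solve-∀ to solve-∀ℤ)
  open import Data.List.Base as List using (List; length)
  open import Data.List.Membership.Propositional using (_∈_)
  open import Data.List.Membership.Propositional.Properties using (∈-∃++)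
  open import Data.List.Relation.Binary.Permutation.Propositional.Properties
    using (↭-length; ∈-resp-↭; shift)
  open import Data.List.Relation.Binary.Subset.Propositional using (_⊆_)
  open import Data.List.Relation.Unary.All as ListAll using ()
  open import Data.List.Relation.Unary.AllPairs as AllPairs using ()
  open import Data.List.Relation.Unary.Any using (here; there)
  open import Data.List.Relation.Unary.Unique.Propositional using (Unique)
  open import Data.Nat.Base
  open import Data.Nat.Coprimality using (Coprime; coprime-divisor)
  open import Data.Nat.Divisibility
  open import Data.Nat.DivMod
  open import Data.Nat.GCD using (gcd; gcd[m,n]∣m; gcd[m,n]∣n)
  open import Data.Nat.Properties
  open import Data.Nat.Tactic.RingSolver using (solve-∀)
  open import Data.Product.Base using (∃; Σ; _×_; _,_; proj₁; proj₂)
  import Data.Rational.Base as ℚ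
  import Data.Rational.Properties as ℚ
  open import Data.Rational.Unnormalised.Base as ℚᵘ using (mkℚᵘ; *≡*)
  import Data.Rational.Unnormalised.Properties as ℚᵘ
  open import Data.Sum.Base using (_⊎_; inj₁; inj₂)
  open import Data.Sum.Function.Propositional using (_⊎-↔_)
  open import Data.Vec.Base using (Vec; []; _∷_)
  open import Data.Vec.Properties using (∷-injective)
  open import Data.Vec.Relation.Unary.All using (All; []; _∷_)
  open import Function.Base using (_∘_; it)
  open import Function.Bundles using (_↔_; _⇔_; mk↔ₛ′; mk⤖; mk⇔)
  open import Function.Construct.Composition using (_↔-∘_)
  open import Function.Construct.Identity using (↔-id)
  open import Function.Definitions using (Injective)
  open import Function.Properties.Bijection using (⤖⇒↔)
  open import Relation.Binary.PropositionalEquality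
  open import Relation.Nullary using (yes; no; contradiction)

  open Sum +-0-commutativeMonoid using (sum; sum-cong-≗; ∑-distrib-+; sum-permute)

  -- Finite sums and counting

  ∑< : ℕ → (ℕ → ℕ) → ℕ
  ∑< n f = sum {n} (λ i → f (toℕ i))

  ∑<-cong : ∀ n {f g} → (∀ {t} → t < n → f t ≡ g t) → ∑< n f ≡ ∑< n g
  ∑<-cong n f≗g = sum-cong-≗ {n} (λ i → f≗g (toℕ<n i))

  ∑<-+ : ∀ n f g → ∑< n (λ t → f t + g t) ≡ ∑< n f + ∑< n g
  ∑<-+ n f g = ∑-distrib-+ {n} (f ∘ toℕ) (g ∘ toℕ)

  ∑<-const : ∀ n c → ∑< n (λ _ → c) ≡ n * c
  ∑<-const zero    c = refl
  ∑<-const (suc n) c = cong (c +_) (∑<-const n c)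

  -- Serves summands that are a quotient minus one and so are known only through their successor.
  ∑<-suc : ∀ {n} f g → (∀ {t} → t < n → suc (f t) ≡ g t) → n + ∑< n f ≡ ∑< n g
  ∑<-suc {n} f g eq = begin
    n + ∑< n f                    ≡⟨ cong (_+ ∑< n f) (trans (∑<-const n 1) (*-identityʳ n)) ⟨
    ∑< n (λ _ → 1) + ∑< n f       ≡⟨ ∑<-+ n (λ _ → 1) f ⟨
    ∑< n (suc ∘ f)                ≡⟨ ∑<-cong n eq ⟩
    ∑< n g                        ∎
    where open ≡-Reasoning

  ∑<-* : ∀ n c f → ∑< n (λ t → c * f t) ≡ c * ∑< n f
  ∑<-* zero    c f = sym (*-zeroʳ c)
  ∑<-* (suc n) c f = trans (cong (c * f 0 +_) (∑<-* n c (f ∘ suc)))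
                           (sym (*-distribˡ-+ c (f 0) _))

  ∑<-split : ∀ m n f → ∑< (m + n) f ≡ ∑< m f + ∑< n (λ t → f (m + t))
  ∑<-split zero    n f = refl
  ∑<-split (suc m) n f = trans (cong (f 0 +_) (∑<-split m n (f ∘ suc))) (sym (+-assoc (f 0) _ _))

  ∑<-reverse : ∀ n f → ∑< n f ≡ ∑< n (λ t → f (n ∸ suc t))
  ∑<-reverse n f =
    trans (sum-permute (f ∘ toℕ) (reverse {n}))
          (sum-cong-≗ {n} (λ i → cong f (opposite-prop i)))

  Fin-sum↔Σ : ∀ {n} (f : Fin n → ℕ) → Fin (sum f) ↔ Σ (Fin n) (Fin ∘ f)
  Fin-sum↔Σ {zero}  f = mk↔ₛ′ (λ ()) (λ ()) (λ ()) (λ ())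
  Fin-sum↔Σ {suc n} f =
    mk↔ₛ′ (λ { (inj₁ j)       → Fin.zero , j
             ; (inj₂ (i , j)) → Fin.suc i , j })
          (λ { (Fin.zero , j)  → inj₁ j
             ; (Fin.suc i , j) → inj₂ (i , j) })
          (λ { (Fin.zero , j)  → refl
             ; (Fin.suc i , j) → refl })
          (λ { (inj₁ j)       → refl
             ; (inj₂ (i , j)) → refl })
    ↔-∘ ((↔-id _ ⊎-↔ Fin-sum↔Σ (f ∘ Fin.suc)) ↔-∘ +↔⊎)

  -- Pigeonhole: if `y` were missed, punching it out of the codomain would leave an injection into a
  -- set with one element fewer.
  injective⇒surjective : ∀ {n} (f : Fin n → Fin n) → Injective _≡_ _≡_ f → ∀ y → ∃ λ x → f x ≡ y
  injective⇒surjective {suc n} f f-inj y with any? (λ x → f x Fin.≟ y)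
  ... | yes p = p
  ... | no ¬p = contradiction
    (injective⇒≤ (λ {i} {j} → f-inj ∘ punchOut-injective (avoids i) (avoids j))) 1+n≰n
    where
    avoids : ∀ x → y ≢ f x
    avoids x y≡fx = ¬p (x , sym y≡fx)

  -- Remove from `ys` one occurrence of the head of `xs`. The tail differs from the head everywhere,
  -- so it is still contained in what remains.
  length-mono-⊆ : ∀ {a} {X : Set a} {xs ys : List X} → Unique xs → xs ⊆ ys → length xs ≤ length ys
  length-mono-⊆ AllPairs.[] _ = z≤n
  length-mono-⊆ {xs = x List.∷ xs} {ys} (x∉xs AllPairs.∷ uniq) xs⊆ys
    with as , bs , refl ← ∈-∃++ (xs⊆ys (here refl)) =
    ≤-trans (s≤s (length-mono-⊆ uniq xs⊆as++bs)) (≤-reflexive (sym (↭-length (shift x as bs))))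
    where
    xs⊆as++bs : xs ⊆ as List.++ bs
    xs⊆as++bs {y} y∈xs with ∈-resp-↭ (shift x as bs) (xs⊆ys (there y∈xs))
    ... | here y≡x = contradiction (sym y≡x) (ListAll.lookup x∉xs y∈xs)
    ... | there y∈ = y∈

  -- Solutions in a residue class

  module FloorSum (A B : ℕ) {{_ : NonZero A}} (A⊥B : Coprime A B) where

    ρ φ : ℕ → ℕ
    ρ t = (B * t) % A
    φ t = (B * t) / A

    Bt≡ρ+Aφ : ∀ t → B * t ≡ ρ t + A * φ t
    Bt≡ρ+Aφ t = trans (m≡m%n+[m/n]*n (B * t) A) (cong (ρ t +_) (*-comm (φ t) A))

    -- Equal remainders make A divide B (t - s), hence t - s, which is smaller than A. The
    -- assumption s ≤ t makes the truncated subtraction genuine.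
    ρ-injective-≤ : ∀ {s t} → s ≤ t → t < A → ρ s ≡ ρ t → s ≡ t
    ρ-injective-≤ {s} {t} s≤t t<A eq = ≤-antisym s≤t (m∸n≡0⇒m≤n t∸s≡0)
      where
      open ≡-Reasoning
      A∣t∸s : A ∣ t ∸ s
      A∣t∸s = coprime-divisor A⊥B (divides (φ t ∸ φ s) (begin
        B * (t ∸ s)                         ≡⟨ *-distribˡ-∸ B t s ⟩
        B * t ∸ B * s                       ≡⟨ cong₂ _∸_ (Bt≡ρ+Aφ t) (Bt≡ρ+Aφ s) ⟩
        (ρ t + A * φ t) ∸ (ρ s + A * φ s)   ≡⟨ cong (λ r → (ρ t + A * φ t) ∸ (r + A * φ s)) eq ⟩
        (ρ t + A * φ t) ∸ (ρ t + A * φ s)   ≡⟨ [m+n]∸[m+o]≡n∸o (ρ t) _ _ ⟩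
        A * φ t ∸ A * φ s                   ≡⟨ *-distribˡ-∸ A (φ t) (φ s) ⟨
        A * (φ t ∸ φ s)                     ≡⟨ *-comm A _ ⟩
        (φ t ∸ φ s) * A                     ∎))
      t∸s≡0 : t ∸ s ≡ 0
      t∸s≡0 with t ∸ s | A∣t∸s | m∸n≤m t s
      ... | zero  | _ | _   = refl
      ... | suc e | p | e≤t = contradiction (∣⇒≤ p) (<⇒≱ (≤-<-trans e≤t t<A))

    ρ-injective : ∀ {s t} → s < A → t < A → ρ s ≡ ρ t → s ≡ t
    ρ-injective {s} {t} s<A t<A eq with ≤-total s t
    ... | inj₁ s≤t = ρ-injective-≤ s≤t t<A eq
    ... | inj₂ t≤s = sym (ρ-injective-≤ t≤s s<A (sym eq))

    ρ>0 : ∀ {t} → 0 < t → t < A → 0 < ρ t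
    ρ>0 {t} 0<t t<A = n≢0⇒n>0 λ ρ≡0 →
      contradiction (∣⇒≤ {{>-nonZero 0<t}} (coprime-divisor A⊥B (m%n≡0⇒n∣m (B * t) A ρ≡0))) (<⇒≱ t<A)

    -- Adding the two divisions gives A B = ρ s + ρ t + A K. Both remainders lie strictly between 0
    -- and A, so their sum lies strictly between 0 and 2 A, which leaves only K = B - 1.
    φ-reflect : ∀ {s t} → 0 < s → 0 < t → s + t ≡ A → suc (φ s + φ t) ≡ B
    φ-reflect {s} {t} 0<s 0<t s+t≡A = ≤-antisym K<B B≤1+K
      where
      K = φ s + φ t
      s<A : s < A
      s<A = subst (s <_) s+t≡A (m<m+n s 0<t)
      t<A : t < A
      t<A = subst (t <_) s+t≡A (m<n+m t 0<s)
      AB≡ : A * B ≡ ρ s + ρ t + A * K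
      AB≡ = begin
        A * B                             ≡⟨ cong (_* B) s+t≡A ⟨
        (s + t) * B                       ≡⟨ regroup₁ s t B ⟩
        B * s + B * t                     ≡⟨ cong₂ _+_ (Bt≡ρ+Aφ s) (Bt≡ρ+Aφ t) ⟩
        (ρ s + A * φ s) + (ρ t + A * φ t) ≡⟨ regroup₂ (ρ s) (φ s) (ρ t) (φ t) A ⟩
        ρ s + ρ t + A * K                 ∎
        where
        open ≡-Reasoning
        regroup₁ : ∀ s t B → (s + t) * B ≡ B * s + B * t
        regroup₁ = solve-∀
        regroup₂ : ∀ r p r′ p′ A → (r + A * p) + (r′ + A * p′) ≡ r + r′ + A * (p + p′)
        regroup₂ = solve-∀
      open ≤-Reasoning
      K<B : K < B
      K<B = *-cancelˡ-< A K B (begin-strict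
        A * K                   <⟨ m<n+m (A * K) (≤-trans (ρ>0 0<s s<A) (m≤m+n _ _)) ⟩
        ρ s + ρ t + A * K       ≡⟨ AB≡ ⟨
        A * B                   ∎)
      B≤1+K : B ≤ suc K
      B≤1+K = s≤s⁻¹ (*-cancelˡ-< A B (2 + K) (begin-strict
        A * B                   ≡⟨ AB≡ ⟩
        ρ s + ρ t + A * K       <⟨ +-monoˡ-< (A * K) (+-mono-< (m%n<n (B * s) A) (m%n<n (B * t) A)) ⟩
        A + A + A * K           ≡⟨ regroup A K ⟩
        A * (2 + K)             ∎))
        where
        regroup : ∀ A K → A + A + A * K ≡ A * (2 + K)
        regroup = solve-∀

    -- Sylvester's count for two generators. The term at 0 vanishes, and pairing t with A - t for 0
    -- < t < A gives A - 1 pairs, each contributing B - 1.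
    2∑φ : 2 * ∑< A φ + A + B ≡ A * B + 1
    2∑φ = begin
      2 * ∑< A φ + A + B
        ≡⟨ cong (λ n → 2 * ∑< n φ + n + B) (sym (suc-pred A)) ⟩
      2 * (φ 0 + ∑< a (φ ∘ suc)) + suc a + B
        ≡⟨ cong (λ e → 2 * (e + ∑< a (φ ∘ suc)) + suc a + B) φ0≡0 ⟩
      2 * ∑< a (φ ∘ suc) + suc a + B
        ≡⟨ regroup₁ (∑< a (φ ∘ suc)) a B ⟩
      a * 1 + (∑< a (φ ∘ suc) + ∑< a (φ ∘ suc)) + 1 + B
        ≡⟨ cong (λ e → e + 1 + B) paired ⟩
      a * B + 1 + B
        ≡⟨ regroup₂ a B ⟩
      suc a * B + 1
        ≡⟨ cong (λ n → n * B + 1) (suc-pred A) ⟩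
      A * B + 1 ∎
      where
      open ≡-Reasoning
      a = pred A
      φ0≡0 : φ 0 ≡ 0
      φ0≡0 = trans (cong (_/ A) (*-zeroʳ B)) (0/n≡0 A)
      regroup₁ : ∀ X a B → 2 * X + suc a + B ≡ a * 1 + (X + X) + 1 + B
      regroup₁ = solve-∀
      regroup₂ : ∀ a B → a * B + 1 + B ≡ suc a * B + 1
      regroup₂ = solve-∀
      reflected : ℕ → ℕ
      reflected t = φ (suc (a ∸ suc t))
      paired : a * 1 + (∑< a (φ ∘ suc) + ∑< a (φ ∘ suc)) ≡ a * B
      paired = begin
        a * 1 + (∑< a (φ ∘ suc) + ∑< a (φ ∘ suc))
          ≡⟨ cong₂ (λ x y → x + (∑< a (φ ∘ suc) + y)) (sym (∑<-const a 1)) (∑<-reverse a (φ ∘ suc)) ⟩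
        ∑< a (λ _ → 1) + (∑< a (φ ∘ suc) + ∑< a reflected)
          ≡⟨ cong (∑< a (λ _ → 1) +_) (∑<-+ a (φ ∘ suc) reflected) ⟨
        ∑< a (λ _ → 1) + ∑< a (λ t → φ (suc t) + reflected t)
          ≡⟨ ∑<-+ a (λ _ → 1) (λ t → φ (suc t) + reflected t) ⟨
        ∑< a (λ t → suc (φ (suc t) + reflected t))
          ≡⟨ ∑<-cong a (λ {t} t<a → φ-reflect (s≤s z≤n) (s≤s z≤n) (begin
               suc t + suc (a ∸ suc t)   ≡⟨ +-suc (suc t) _ ⟩
               suc (suc t + (a ∸ suc t)) ≡⟨ cong suc (m+[n∸m]≡n t<a) ⟩
               suc a                     ≡⟨ suc-pred A ⟩
               A                         ∎)) ⟩
        ∑< a (λ _ → B)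
          ≡⟨ ∑<-const a B ⟩
        a * B ∎

  -- Solutions as points, and the 2-Sylvester number as a sum of thresholds

  module Residues
    (A B C G H : ℕ) {{_ : NonZero A}} {{_ : NonZero B}} {{_ : NonZero C}} {{_ : NonZero G}}
    (A⊥B : Coprime A B) (C+AH≡BG : C + A * H ≡ B * G)
    where

    open FloorSum A B A⊥B

    gens : Vec ℕ 3
    gens = A ∷ B ∷ C ∷ []

    ρ-surjective : ∀ n → ∃ λ (i : Fin A) → ρ (toℕ i) ≡ n % A
    ρ-surjective n with injective⇒surjective (λ i → fromℕ< (m%n<n (B * toℕ i) A)) inj (fromℕ< (m%n<n n A))
      where
      inj : Injective _≡_ _≡_ (λ (i : Fin A) → fromℕ< (m%n<n (B * toℕ i) A))
      inj {i} {j} eq = toℕ-injective (ρ-injective (toℕ<n i) (toℕ<n j) (Fin.fromℕ<-injective _ _ _ _ eq))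
    ... | i , eq = i , Fin.fromℕ<-injective _ _ _ _ eq

    -- The number n with n ≡ B t (mod A) and ⌊n / A⌋ = j. For t < A and arbitrary j every natural
    -- number arises exactly once.
    ρ+ : ℕ → ℕ → ℕ
    ρ+ t j = ρ t + j * A

    -- The point (u , z) stands for y = t + uA − Gz; it gives a solution with residue ρ t
    -- as soon as y and the resulting x are nonnegative.
    Point : Set
    Point = ℕ × ℕ

    Good : ℕ → Point → Set
    Good t (u , z) = z * G ≤ t + u * A

    Reaches : ℕ → ℕ → Point → Set
    Reaches t j (u , z) = φ t + B * u ≤ j + H * z

    solution : ℕ → ℕ → Point → Vec ℕ 3
    solution t j (u , z) = (j + H * z ∸ (φ t + B * u)) ∷ (t + u * A ∸ z * G) ∷ z ∷ []

    -- The substitution behind the whole count, with A (j + H z) added so that no subtraction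
    -- occurs. Both directions of the correspondence between solutions and points read off x from
    -- it.
    balance : ∀ {t u x y z} j → y + z * G ≡ t + u * A →
      gens · (x ∷ y ∷ z ∷ []) + A * (j + H * z) ≡ ρ+ t j + A * (x + (φ t + B * u))
    balance {t} {u} {x} {y} {z} j y+zG = begin
      A * x + (B * y + (C * z + 0)) + A * (j + H * z)
        ≡⟨ regroup₁ A B C H x y z j ⟩
      A * (x + j) + (B * y + (C + A * H) * z)
        ≡⟨ cong (λ c → A * (x + j) + (B * y + c * z)) C+AH≡BG ⟩
      A * (x + j) + (B * y + B * G * z)
        ≡⟨ cong (A * (x + j) +_) (regroup₂ B G y z) ⟩
      A * (x + j) + B * (y + z * G)
        ≡⟨ cong (λ s → A * (x + j) + B * s) y+zG ⟩
      A * (x + j) + B * (t + u * A)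
        ≡⟨ cong (A * (x + j) +_) (*-distribˡ-+ B t (u * A)) ⟩
      A * (x + j) + (B * t + B * (u * A))
        ≡⟨ cong (λ b → A * (x + j) + (b + B * (u * A))) (Bt≡ρ+Aφ t) ⟩
      A * (x + j) + (ρ t + A * φ t + B * (u * A))
        ≡⟨ regroup₃ A B x j (ρ t) (φ t) u ⟩
      ρ+ t j + A * (x + (φ t + B * u)) ∎
      where
      open ≡-Reasoning
      regroup₁ : ∀ A B C H x y z j → A * x + (B * y + (C * z + 0)) + A * (j + H * z)
        ≡ A * (x + j) + (B * y + (C + A * H) * z)
      regroup₁ = solve-∀
      regroup₂ : ∀ B G y z → B * y + B * G * z ≡ B * (y + z * G)
      regroup₂ = solve-∀
      regroup₃ : ∀ A B x j r p u → A * (x + j) + (r + A * p + B * (u * A))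
        ≡ r + j * A + A * (x + (p + B * u))
      regroup₃ = solve-∀

    solution-solves : ∀ {t j} P → Good t P → Reaches t j P → gens · solution t j P ≡ ρ+ t j
    solution-solves {t} {j} P@(u , z) good reach = +-cancelʳ-≡ (A * (j + H * z)) _ _ (begin
      gens · solution t j P + A * (j + H * z)                           ≡⟨ balance j (m∸n+n≡m good) ⟩
      ρ+ t j + A * (j + H * z ∸ (φ t + B * u) + (φ t + B * u))          ≡⟨ cong (λ e → ρ+ t j + A * e) (m∸n+n≡m reach) ⟩
      ρ+ t j + A * (j + H * z)                                          ∎)
      where open ≡-Reasoning

    solution-complete : ∀ {t j xs} → t < A → gens · xs ≡ ρ+ t j →
      ∃ λ P → Good t P × Reaches t j P × xs ≡ solution t j P
    solution-complete {t} {j} {x ∷ y ∷ z ∷ []} t<A solves =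
      (u , z) , good , reach ,
      cong₂ (λ x y → x ∷ y ∷ z ∷ []) (sym (trans (cong (_∸ (φ t + B * u)) (sym x+)) (m+n∸n≡m x (φ t + B * u))))
                                     (sym (trans (cong (_∸ z * G) (sym y+)) (m+n∸n≡m y (z * G))))
      where
      open ≡-Reasoning
      s = y + z * G
      u = s / A
      expand : s ≡ s % A + u * A
      expand = m≡m%n+[m/n]*n s A
      -- Reducing `balance` modulo A leaves only the two residues; injectivity of ρ below A then
      -- identifies s mod A with t.
      ρ≡ : ρ t ≡ ρ (s % A)
      ρ≡ = begin
        ρ t                       ≡⟨ m%n%n≡m%n (B * t) A ⟨
        ρ t % A                   ≡⟨ [m+kn]%n≡m%n (ρ t) j A ⟨
        ρ+ t j % A                ≡⟨ cong (_% A) solves ⟨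
        (gens · (x ∷ y ∷ z ∷ [])) % A
          ≡⟨ [m+kn]%n≡m%n _ (j + H * z) A ⟨
        (gens · (x ∷ y ∷ z ∷ []) + (j + H * z) * A) % A
          ≡⟨ cong (λ e → (gens · (x ∷ y ∷ z ∷ []) + e) % A) (*-comm (j + H * z) A) ⟩
        (gens · (x ∷ y ∷ z ∷ []) + A * (j + H * z)) % A
          ≡⟨ cong (_% A) (balance j expand) ⟩
        (ρ (s % A) + j * A + A * (x + (φ (s % A) + B * u))) % A
          ≡⟨ cong (_% A) (regroup (ρ (s % A)) A j (x + (φ (s % A) + B * u))) ⟩
        (ρ (s % A) + (j + (x + (φ (s % A) + B * u))) * A) % A
          ≡⟨ [m+kn]%n≡m%n (ρ (s % A)) (j + (x + (φ (s % A) + B * u))) A ⟩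
        ρ (s % A) % A             ≡⟨ m%n%n≡m%n _ A ⟩
        ρ (s % A)                 ∎
        where
        regroup : ∀ r A j k → r + j * A + A * k ≡ r + (j + k) * A
        regroup = solve-∀
      y+ : s ≡ t + u * A
      y+ = trans expand (cong (_+ u * A) (sym (ρ-injective t<A (m%n<n s A) ρ≡)))
      x+ : x + (φ t + B * u) ≡ j + H * z
      x+ = sym (*-cancelˡ-≡ _ _ A (+-cancelˡ-≡ (ρ+ t j) _ _
        (trans (cong (_+ A * (j + H * z)) (sym solves)) (balance j y+))))
      good : z * G ≤ t + u * A
      good = subst (z * G ≤_) y+ (m≤n+m _ y)
      reach : φ t + B * u ≤ j + H * z
      reach = subst (φ t + B * u ≤_) x+ (m≤n+m _ x)

    -- The last entry is z itself, and the middle one then determines u, since its subtraction is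
    -- exact for good points.
    solution-injective : ∀ {t j P Q} → Good t P → Good t Q → solution t j P ≡ solution t j Q → P ≡ Q
    solution-injective {t} {j} {u , z} {u′ , z′} good good′ eq
      with _ , eq₁ ← ∷-injective eq
      with eqy , eq₂ ← ∷-injective eq₁
      with refl , _ ← ∷-injective eq₂
      = cong (_, z) (*-cancelʳ-≡ u u′ A (+-cancelˡ-≡ t _ _ (∸-cancelʳ-≡ good good′ eqy)))

    infix 4 _≼_

    -- Compares the values B u - H z, written additively to stay in ℕ.
    _≼_ : Point → Point → Set
    (u , z) ≼ (u′ , z′) = B * u + H * z′ ≤ B * u′ + H * z

    ≼-reaches : ∀ {t j} P Q → P ≼ Q → Reaches t j Q → Reaches t j P
    ≼-reaches {t} {j} (u , z) (u′ , z′) P≼Q reach = +-cancelʳ-≤ (H * z′) _ _ (begin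
      φ t + B * u + H * z′       ≡⟨ +-assoc (φ t) _ _ ⟩
      φ t + (B * u + H * z′)     ≤⟨ +-monoʳ-≤ (φ t) P≼Q ⟩
      φ t + (B * u′ + H * z)     ≡⟨ +-assoc (φ t) _ _ ⟨
      φ t + B * u′ + H * z       ≤⟨ +-monoˡ-≤ (H * z) reach ⟩
      j + H * z′ + H * z         ≡⟨ swap j (H * z′) (H * z) ⟩
      j + H * z + H * z′         ∎)
      where
      open ≤-Reasoning
      swap : ∀ a b c → a + b + c ≡ a + c + b
      swap = solve-∀

    -- Third smallest with multiplicity: ties in B u - H z may be broken in any way, and the order
    -- of `P₁` and `P₂` between themselves is left open.
    record IsThird (t : ℕ) (P₃ : Point) : Set where
      field
        P₁ P₂   : Point
        good₁   : Good t P₁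
        good₂   : Good t P₂
        good₃   : Good t P₃
        P₁≢P₂   : P₁ ≢ P₂
        P₁≢P₃   : P₁ ≢ P₃
        P₂≢P₃   : P₂ ≢ P₃
        P₁≼P₃   : P₁ ≼ P₃
        P₂≼P₃   : P₂ ≼ P₃
        minimal : ∀ Q → Good t Q → Q ≡ P₁ ⊎ Q ≡ P₂ ⊎ P₃ ≼ Q

    threshold : ℕ → Point → ℕ
    threshold t (u , z) = φ t + B * u ∸ H * z

    reaches⇒threshold≤ : ∀ {t j} P → Reaches t j P → threshold t P ≤ j
    reaches⇒threshold≤ {t} {j} (u , z) reach =
      m≤n+o⇒m∸n≤o _ (H * z) (subst (φ t + B * u ≤_) (+-comm j (H * z)) reach)

    threshold≤⇒reaches : ∀ {t j} P → threshold t P ≤ j → Reaches t j P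
    threshold≤⇒reaches {t} {j} (u , z) le =
      subst (φ t + B * u ≤_) (+-comm (H * z) j) (≤-trans (m≤n+m∸n _ (H * z)) (+-monoʳ-≤ (H * z) le))

    positive : All NonZero gens
    positive = it ∷ it ∷ it ∷ []

    -- By contraposition: once the threshold is at most j, `P₃` reaches j, hence so do `P₁` and
    -- `P₂`, and three distinct good points give three distinct solutions.
    d≤2⇒<threshold : ∀ {t j P} → IsThird t P → d (ρ+ t j) gens ≤ 2 → j < threshold t P
    d≤2⇒<threshold {t} {j} {P₃} third d≤2 = ≰⇒> λ threshold≤j →
      let reach₃ = threshold≤⇒reaches {t} P₃ threshold≤j
          reach₁ = ≼-reaches {t} {j} P₁ P₃ P₁≼P₃ reach₃
          reach₂ = ≼-reaches {t} {j} P₂ P₃ P₂≼P₃ reach₃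
          member = λ {P} good reach → ∈-solutions positive (solution-solves {t} {j} P good reach)
      in contradiction (≤-trans (length-mono-⊆ three-unique
           λ { (here refl)                 → member good₁ reach₁
             ; (there (here refl))         → member good₂ reach₂
             ; (there (there (here refl))) → member good₃ reach₃ }) d≤2) 1+n≰n
      where
      open IsThird third
      three-unique : Unique (List.map (solution t j) (P₁ List.∷ P₂ List.∷ P₃ List.∷ List.[]))
      three-unique = ((P₁≢P₂ ∘ solution-injective {t} {j} good₁ good₂) ListAll.∷
                      (P₁≢P₃ ∘ solution-injective {t} {j} good₁ good₃) ListAll.∷ ListAll.[]) AllPairs.∷
                     ((P₂≢P₃ ∘ solution-injective {t} {j} good₂ good₃) ListAll.∷ ListAll.[]) AllPairs.∷
                     ListAll.[] AllPairs.∷ AllPairs.[]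

    -- Every solution comes from a good point that reaches j. Were it neither `P₁` nor `P₂`,
    -- minimality would make `P₃` reach j as well.
    <threshold⇒d≤2 : ∀ {t j P} → t < A → IsThird t P → j < threshold t P → d (ρ+ t j) gens ≤ 2
    <threshold⇒d≤2 {t} {j} {P₃} t<A third j< =
      length-mono-⊆ {ys = List.map (solution t j) (P₁ List.∷ P₂ List.∷ List.[])}
        (solutions-unique _ gens) (λ {xs} → classify {xs} ∘ solutions-sound _ gens {xs})
      where
      open IsThird third
      classify : ∀ {xs} → gens · xs ≡ ρ+ t j → xs ∈ List.map (solution t j) (P₁ List.∷ P₂ List.∷ List.[])
      classify {xs} solves with solution-complete {t} {j} {xs} t<A solves
      ... | Q , good , reach , refl with minimal Q good
      ...   | inj₁ refl        = here refl
      ...   | inj₂ (inj₁ refl) = there (here refl)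
      ...   | inj₂ (inj₂ P₃≼Q) =
              contradiction (reaches⇒threshold≤ {t} P₃ (≼-reaches {t} P₃ Q P₃≼Q reach)) (<⇒≱ j<)

    module Count (third : ℕ → Point) (isThird : ∀ {t} → t < A → IsThird t (third t)) where

      u₃ z₃ w : ℕ → ℕ
      u₃ = proj₁ ∘ third
      z₃ = proj₂ ∘ third
      w t = threshold t (third t)

      count : Fin (∑< A w) ↔ ∃ λ n → d n gens ≤ 2
      count = ⤖⇒↔ (mk⤖ (injective , λ y → let x , eq = surjective y in x , λ { refl → eq }))
        ↔-∘ Fin-sum↔Σ {A} (w ∘ toℕ)
        where
        to : Σ (Fin A) (Fin ∘ w ∘ toℕ) → ∃ λ n → d n gens ≤ 2
        to (i , j) = ρ+ (toℕ i) (toℕ j) , <threshold⇒d≤2 (toℕ<n i) (isThird (toℕ<n i)) (toℕ<n j)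

        ρ+-% : ∀ t j → ρ+ t j % A ≡ ρ t
        ρ+-% t j = trans ([m+kn]%n≡m%n (ρ t) j A) (m%n%n≡m%n (B * t) A)

        injective : Injective _≡_ _≡_ to
        injective {i , j} {i′ , j′} eq
          with refl ← toℕ-injective {i = i} {i′} (ρ-injective (toℕ<n i) (toℕ<n i′)
            (trans (sym (ρ+-% (toℕ i) (toℕ j))) (trans (cong (λ y → proj₁ y % A) eq) (ρ+-% (toℕ i′) (toℕ j′)))))
          = cong (i ,_) (toℕ-injective (*-cancelʳ-≡ _ _ A (+-cancelˡ-≡ (ρ (toℕ i)) _ _ (cong proj₁ eq))))

        surjective : ∀ y → ∃ λ x → to x ≡ y
        surjective (n , d≤2) = (i , fromℕ< j<w) , Σ-≡ (trans (cong (ρ+ (toℕ i)) (toℕ-fromℕ< j<w)) n≡)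
          where
          i = proj₁ (ρ-surjective n)
          j = n / A
          n≡ : ρ+ (toℕ i) j ≡ n
          n≡ = trans (cong (_+ j * A) (proj₂ (ρ-surjective n))) (sym (m≡m%n+[m/n]*n n A))
          j<w : j < w (toℕ i)
          j<w = d≤2⇒<threshold (isThird (toℕ<n i)) (subst (λ n → d n gens ≤ 2) (sym n≡) d≤2)
          -- The bound on `d` is a proposition, so pairs agree as soon as the numbers do.
          Σ-≡ : ∀ {n n′} {p : d n gens ≤ 2} {p′ : d n′ gens ≤ 2} → n ≡ n′ → (n , p) ≡ (n′ , p′)
          Σ-≡ refl = cong (_ ,_) (≤-irrelevant _ _)

      -- Makes the truncated subtraction in `threshold` exact on good points, so that thresholds can
      -- be summed. Since A H ≤ B G, goodness gives A H z ≤ B (t + u A), and B t < A (φ t + 1)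
      -- yields a strict bound from which A cancels.
      Hz≤φ+Bu : ∀ t P → Good t P → H * proj₂ P ≤ φ t + B * proj₁ P
      Hz≤φ+Bu t (u , z) good = s≤s⁻¹ (*-cancelˡ-< A _ _ (begin-strict
        A * (H * z)                       ≡⟨ *-assoc A H z ⟨
        A * H * z                         ≤⟨ *-monoˡ-≤ z (m≤n+m (A * H) C) ⟩
        (C + A * H) * z                   ≡⟨ cong (_* z) C+AH≡BG ⟩
        B * G * z                         ≡⟨ swap B G z ⟩
        B * (z * G)                       ≤⟨ *-monoʳ-≤ B good ⟩
        B * (t + u * A)                   ≡⟨ *-distribˡ-+ B t (u * A) ⟩
        B * t + B * (u * A)               ≡⟨ cong (_+ B * (u * A)) (Bt≡ρ+Aφ t) ⟩
        ρ t + A * φ t + B * (u * A)       <⟨ +-monoˡ-< (B * (u * A)) (+-monoˡ-< (A * φ t) (m%n<n (B * t) A)) ⟩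
        A + A * φ t + B * (u * A)         ≡⟨ regroup A B (φ t) u ⟩
        A * suc (φ t + B * u)             ∎))
        where
        open ≤-Reasoning
        swap : ∀ B G z → B * G * z ≡ B * (z * G)
        swap = solve-∀
        regroup : ∀ A B p u → A + A * p + B * (u * A) ≡ A * suc (p + B * u)
        regroup = solve-∀

      ∑w : ∑< A w + H * ∑< A z₃ ≡ ∑< A φ + B * ∑< A u₃
      ∑w = begin
        ∑< A w + H * ∑< A z₃                   ≡⟨ cong (∑< A w +_) (∑<-* A H z₃) ⟨
        ∑< A w + ∑< A (λ t → H * z₃ t)         ≡⟨ ∑<-+ A w (λ t → H * z₃ t) ⟨
        ∑< A (λ t → w t + H * z₃ t)
          ≡⟨ ∑<-cong A (λ {t} t<A → m∸n+n≡m (Hz≤φ+Bu t (third t) (IsThird.good₃ (isThird t<A)))) ⟩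
        ∑< A (λ t → φ t + B * u₃ t)            ≡⟨ ∑<-+ A φ (λ t → B * u₃ t) ⟩
        ∑< A φ + ∑< A (λ t → B * u₃ t)         ≡⟨ cong (∑< A φ +_) (∑<-* A B u₃) ⟩
        ∑< A φ + B * ∑< A u₃                   ∎
        where open ≡-Reasoning

  -- Sums of the quotients ⌊t / G⌋

  module QuotientSum (G : ℕ) {{_ : NonZero G}} where

    S : ℕ → ℕ
    S n = ∑< n (_/ G)

    [G+n]/G : ∀ n → (G + n) / G ≡ suc (n / G)
    [G+n]/G n = trans (+-distrib-/-∣ˡ n ∣-refl) (cong (_+ n / G) (n/n≡1 G))

    S-small : ∀ {n} → n ≤ G → S n ≡ 0
    S-small {n} n≤G = trans (∑<-cong n (λ t<n → m<n⇒m/n≡0 (<-≤-trans t<n n≤G)))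
                            (trans (∑<-const n 0) (*-zeroʳ n))

    S-shift : ∀ a n → S a + ∑< n (λ t → (a + t) / G) ≡ S (a + n)
    S-shift a n = sym (∑<-split a n (_/ G))

    S-step : ∀ n → S (G + n) ≡ n + S n
    S-step n = begin
      S (G + n)                             ≡⟨ S-shift G n ⟨
      S G + ∑< n (λ t → (G + t) / G)        ≡⟨ cong (_+ ∑< n (λ t → (G + t) / G)) (S-small ≤-refl) ⟩
      ∑< n (λ t → (G + t) / G)              ≡⟨ ∑<-cong n (λ {t} _ → [G+n]/G t) ⟩
      ∑< n (λ t → suc (t / G))              ≡⟨ ∑<-+ n (λ _ → 1) (_/ G) ⟩
      ∑< n (λ _ → 1) + S n                  ≡⟨ cong (_+ S n) (trans (∑<-const n 1) (*-identityʳ n)) ⟩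
      n + S n                               ∎
      where open ≡-Reasoning

    -- Induction on r, peeling off one block of length G at a time. The bound m ≤ G is not strict,
    -- so that m may be one more than a remainder modulo G.
    2S : ∀ r {m} → m ≤ G → 2 * S (m + r * G) + G * (r * suc r) ≡ 2 * (r * (m + r * G))
    2S zero    {m} m≤G = begin
      2 * S (m + 0) + G * 0 ≡⟨ cong₂ (λ k e → 2 * S k + e) (+-identityʳ m) (*-zeroʳ G) ⟩
      2 * S m + 0           ≡⟨ cong (λ e → 2 * e + 0) (S-small m≤G) ⟩
      0                     ∎
      where open ≡-Reasoning
    2S (suc r) {m} m≤G = begin
      2 * S (m + (G + r * G)) + G * (suc r * suc (suc r))
        ≡⟨ cong (λ k → 2 * S k + G * (suc r * suc (suc r))) (swap m G (r * G)) ⟩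
      2 * S (G + (m + r * G)) + G * (suc r * suc (suc r))
        ≡⟨ cong (λ e → 2 * e + G * (suc r * suc (suc r))) (S-step (m + r * G)) ⟩
      2 * (m + r * G + S (m + r * G)) + G * (suc r * suc (suc r))
        ≡⟨ regroup₁ (S (m + r * G)) m r G ⟩
      2 * S (m + r * G) + G * (r * suc r) + (2 * m + 2 * (r * G) + 2 * G * suc r)
        ≡⟨ cong (_+ (2 * m + 2 * (r * G) + 2 * G * suc r)) (2S r m≤G) ⟩
      2 * (r * (m + r * G)) + (2 * m + 2 * (r * G) + 2 * G * suc r)
        ≡⟨ regroup₂ m r G ⟩
      2 * (suc r * (m + (G + r * G))) ∎
      where
      open ≡-Reasoning
      swap : ∀ a b c → a + (b + c) ≡ b + (a + c)
      swap = solve-∀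
      regroup₁ : ∀ X m r G → 2 * (m + r * G + X) + G * (suc r * suc (suc r))
        ≡ 2 * X + G * (r * suc r) + (2 * m + 2 * (r * G) + 2 * G * suc r)
      regroup₁ = solve-∀
      regroup₂ : ∀ m r G → 2 * (r * (m + r * G)) + (2 * m + 2 * (r * G) + 2 * G * suc r)
        ≡ 2 * (suc r * (m + (G + r * G)))
      regroup₂ = solve-∀

  -- The third smallest value

  record Admissible (A B C G H : ℕ) : Set where
    field
      {{A≢0}} : NonZero A
      {{B≢0}} : NonZero B
      {{C≢0}} : NonZero C
      {{G≢0}} : NonZero G
      A⊥B     : Coprime A B
      C+AH≡BG : C + A * H ≡ B * G
      2H≤G    : 2 * H ≤ G
      5A≤2B   : 5 * A ≤ 2 * B

  -- u and z stand for the sums over t < A of the coordinates of the third smallest point.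
  record Counted (A B C H u z : ℕ) : Set where
    field
      {m}               : ℕ
      isSylvesterNumber : IsSylvesterNumber 2 (A ∷ B ∷ C ∷ []) m
      total             : 2 * m + 2 * (H * z) + A + B ≡ A * B + 1 + 2 * (B * u)

  module Third {A B C G H : ℕ} (admissible : Admissible A B C G H) where

    open Admissible admissible
    open Residues A B C G H A⊥B C+AH≡BG
    open QuotientSum G
    open FloorSum A B A⊥B using (φ; 2∑φ)

    5AH≤BG : 5 * (A * H) ≤ B * G
    5AH≤BG = *-cancelˡ-≤ 2 (begin
      2 * (5 * (A * H))   ≡⟨ regroup₁ A H ⟩
      (5 * A) * (2 * H)   ≤⟨ *-mono-≤ 5A≤2B 2H≤G ⟩
      (2 * B) * G         ≡⟨ *-assoc 2 B G ⟩
      2 * (B * G)         ∎)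
      where
      open ≤-Reasoning
      regroup₁ : ∀ A H → 2 * (5 * (A * H)) ≡ (5 * A) * (2 * H)
      regroup₁ = solve-∀

    -- Dividing out B G ≥ 5 A H: row u₀ + 1 + e costs at most H (t + u A) ≤ (5 + e) A H, where
    -- u₀ ≤ 3 bounds u by 4 + e.
    row-order : ∀ {t} u₀ u z → t < A → u₀ ≤ 3 → u₀ < u → Good t (u , z) → B * u₀ + H * z ≤ B * u
    row-order {t} u₀ u z t<A u₀≤3 u₀<u good with e , refl ← m≤n⇒∃[o]m+o≡n u₀<u =
      *-cancelʳ-≤ _ _ G (begin
        (B * u₀ + H * z) * G                       ≡⟨ regroup₁ B u₀ H z G ⟩
        B * G * u₀ + H * (z * G)                   ≤⟨ +-monoʳ-≤ (B * G * u₀) (*-monoʳ-≤ H good) ⟩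
        B * G * u₀ + H * (t + u * A)               ≤⟨ +-monoʳ-≤ (B * G * u₀) (*-monoʳ-≤ H (+-mono-≤ (<⇒≤ t<A) (*-monoˡ-≤ A u≤4+e))) ⟩
        B * G * u₀ + H * (A + (4 + e) * A)         ≤⟨ +-monoʳ-≤ (B * G * u₀) (m≤m+n _ (4 * H * A * e)) ⟩
        B * G * u₀ + (H * (A + (4 + e) * A) + 4 * H * A * e) ≡⟨ regroup₂ A B G H u₀ e ⟩
        B * G * u₀ + 5 * (A * H) * suc e           ≤⟨ +-monoʳ-≤ (B * G * u₀) (*-monoˡ-≤ (suc e) 5AH≤BG) ⟩
        B * G * u₀ + B * G * suc e                 ≡⟨ regroup₃ B G u₀ e ⟩
        B * u * G                                  ∎)
      where
      open ≤-Reasoning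
      u≤4+e : u ≤ 4 + e
      u≤4+e = +-monoˡ-≤ e (s≤s u₀≤3)
      regroup₁ : ∀ B u₀ H z G → (B * u₀ + H * z) * G ≡ B * G * u₀ + H * (z * G)
      regroup₁ = solve-∀
      regroup₂ : ∀ A B G H u₀ e → B * G * u₀ + (H * (A + (4 + e) * A) + 4 * H * A * e)
        ≡ B * G * u₀ + 5 * (A * H) * suc e
      regroup₂ = solve-∀
      regroup₃ : ∀ B G u₀ e → B * G * u₀ + B * G * suc e ≡ B * suc (u₀ + e) * G
      regroup₃ = solve-∀

    row≼ : ∀ u {z z′} → z′ ≤ z → (u , z) ≼ (u , z′)
    row≼ u z′≤z = +-monoʳ-≤ (B * u) (*-monoʳ-≤ H z′≤z)

    earlier-row≼ : ∀ {t} P Q → t < A → proj₁ P ≤ 3 → proj₁ P < proj₁ Q → Good t Q → P ≼ Q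
    earlier-row≼ {t} (u₀ , z₀) (u , z) t<A u₀≤3 u₀<u good =
      ≤-trans (row-order {t} u₀ u z t<A u₀≤3 u₀<u good) (m≤m+n (B * u) (H * z₀))

    record LastInRow (t u q : ℕ) : Set where
      constructor last
      field
        isGood : Good t (u , q)
        isMax  : ∀ z → Good t (u , z) → z ≤ q

    quotient-last : ∀ {t u n} → n ≡ t + u * A → LastInRow t u (n / G)
    quotient-last {n = n} refl = last (m/n*n≤m n G)
      λ z good → subst (_≤ n / G) (m*n/n≡m z G) (/-monoˡ-≤ G good)

    -- q₀, q₁, q₂ are the largest z in rows 0, 1, 2; row 2 has at least one point, so no later row matters.
    pick : ℕ → ℕ → ℕ → Point
    pick zero          zero    q₂ = 2 , q₂
    pick zero          (suc z) _  = 1 , z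
    pick (suc zero)    q₁      _  = 1 , q₁
    pick (suc (suc z)) _       _  = 0 , z

    good-down : ∀ {t} u {z z′} → z ≤ z′ → Good t (u , z′) → Good t (u , z)
    good-down u z≤z′ good = ≤-trans (*-monoˡ-≤ G z≤z′) good

    ≤-step-cases : ∀ {z n} → z ≤ suc n → z ≡ suc n ⊎ z ≤ n
    ≤-step-cases z≤1+n with m≤n⇒m<n∨m≡n z≤1+n
    ... | inj₁ z<1+n = inj₂ (s≤s⁻¹ z<1+n)
    ... | inj₂ z≡1+n = inj₁ z≡1+n

    -- Within a row the value does not increase with z, so a row is listed from its last z
    -- downwards. Row 0 holds the third point if it has three points; with two, the third is the
    -- last point of row 1; with one, it is the last but one of row 1 if that exists, and otherwise
    -- the last of row 2.
    pick-isThird : ∀ {t q₀ q₁ q₂} → t < A →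
      LastInRow t 0 q₀ → LastInRow t 1 q₁ → LastInRow t 2 q₂ → IsThird t (pick q₀ q₁ q₂)
    pick-isThird {t} {zero} {zero} {q₂} t<A (last g₀ max₀) (last g₁ max₁) (last g₂ max₂) = record
      { P₁ = 0 , 0 ; P₂ = 1 , 0 ; good₁ = g₀ ; good₂ = g₁ ; good₃ = g₂
      ; P₁≢P₂ = λ () ; P₁≢P₃ = λ () ; P₂≢P₃ = λ ()
      ; P₁≼P₃ = earlier-row≼ (0 , 0) (2 , q₂) t<A z≤n (s≤s z≤n) g₂
      ; P₂≼P₃ = earlier-row≼ (1 , 0) (2 , q₂) t<A (s≤s z≤n) (s≤s (s≤s z≤n)) g₂
      ; minimal = min }
      where
      min : ∀ Q → Good t Q → Q ≡ (0 , 0) ⊎ Q ≡ (1 , 0) ⊎ (2 , q₂) ≼ Q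
      min (0 , z) good with refl ← n≤0⇒n≡0 (max₀ z good) = inj₁ refl
      min (1 , z) good with refl ← n≤0⇒n≡0 (max₁ z good) = inj₂ (inj₁ refl)
      min (2 , z) good = inj₂ (inj₂ (row≼ 2 (max₂ z good)))
      min (suc (suc (suc u)) , z) good =
        inj₂ (inj₂ (earlier-row≼ (2 , q₂) (suc (suc (suc u)) , z) t<A (s≤s (s≤s z≤n)) (s≤s (s≤s (s≤s z≤n))) good))
    pick-isThird {t} {zero} {suc q₁} t<A (last g₀ max₀) (last g₁ max₁) _ = record
      { P₁ = 0 , 0 ; P₂ = 1 , suc q₁ ; good₁ = g₀ ; good₂ = g₁ ; good₃ = good-down {t} 1 (n≤1+n q₁) g₁
      ; P₁≢P₂ = λ () ; P₁≢P₃ = λ () ; P₂≢P₃ = λ ()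
      ; P₁≼P₃ = earlier-row≼ (0 , 0) (1 , q₁) t<A z≤n (s≤s z≤n) (good-down {t} 1 (n≤1+n q₁) g₁)
      ; P₂≼P₃ = row≼ 1 (n≤1+n q₁)
      ; minimal = min }
      where
      min : ∀ Q → Good t Q → Q ≡ (0 , 0) ⊎ Q ≡ (1 , suc q₁) ⊎ (1 , q₁) ≼ Q
      min (0 , z) good with refl ← n≤0⇒n≡0 (max₀ z good) = inj₁ refl
      min (1 , z) good with ≤-step-cases (max₁ z good)
      ... | inj₁ refl = inj₂ (inj₁ refl)
      ... | inj₂ z≤q₁ = inj₂ (inj₂ (row≼ 1 z≤q₁))
      min (suc (suc u) , z) good = inj₂ (inj₂ (earlier-row≼ (1 , q₁) (suc (suc u) , z) t<A (s≤s z≤n) (s≤s (s≤s z≤n)) good))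
    pick-isThird {t} {suc zero} {q₁} t<A (last g₀ max₀) (last g₁ max₁) _ = record
      { P₁ = 0 , 1 ; P₂ = 0 , 0 ; good₁ = g₀ ; good₂ = z≤n ; good₃ = g₁
      ; P₁≢P₂ = λ () ; P₁≢P₃ = λ () ; P₂≢P₃ = λ ()
      ; P₁≼P₃ = earlier-row≼ (0 , 1) (1 , q₁) t<A z≤n (s≤s z≤n) g₁
      ; P₂≼P₃ = earlier-row≼ (0 , 0) (1 , q₁) t<A z≤n (s≤s z≤n) g₁
      ; minimal = min }
      where
      min : ∀ Q → Good t Q → Q ≡ (0 , 1) ⊎ Q ≡ (0 , 0) ⊎ (1 , q₁) ≼ Q
      min (0 , z) good with ≤-step-cases (max₀ z good)
      ... | inj₁ refl = inj₁ refl
      ... | inj₂ z≤0 with refl ← n≤0⇒n≡0 z≤0 = inj₂ (inj₁ refl)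
      min (1 , z) good = inj₂ (inj₂ (row≼ 1 (max₁ z good)))
      min (suc (suc u) , z) good = inj₂ (inj₂ (earlier-row≼ (1 , q₁) (suc (suc u) , z) t<A (s≤s z≤n) (s≤s (s≤s z≤n)) good))
    pick-isThird {t} {suc (suc q)} t<A (last g₀ max₀) _ _ = record
      { P₁ = 0 , 2 + q ; P₂ = 0 , 1 + q ; good₁ = g₀
      ; good₂ = good-down {t} 0 (n≤1+n (1 + q)) g₀ ; good₃ = good-down {t} 0 (m≤n+m q 2) g₀
      ; P₁≢P₂ = λ () ; P₁≢P₃ = λ () ; P₂≢P₃ = λ ()
      ; P₁≼P₃ = row≼ 0 (m≤n+m q 2) ; P₂≼P₃ = row≼ 0 (n≤1+n q)
      ; minimal = min }
      where
      min : ∀ Q → Good t Q → Q ≡ (0 , 2 + q) ⊎ Q ≡ (0 , 1 + q) ⊎ (0 , q) ≼ Q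
      min (0 , z) good with ≤-step-cases (max₀ z good)
      ... | inj₁ refl = inj₁ refl
      ... | inj₂ z≤1+q with ≤-step-cases z≤1+q
      ...   | inj₁ refl = inj₂ (inj₁ refl)
      ...   | inj₂ z≤q  = inj₂ (inj₂ (row≼ 0 z≤q))
      min (suc u , z) good = inj₂ (inj₂ (earlier-row≼ (0 , q) (suc u , z) t<A z≤n (s≤s z≤n) good))

    third : ℕ → Point
    third t = pick (t / G) ((A + t) / G) ((A + A + t) / G)

    third-isThird : ∀ {t} → t < A → IsThird t (third t)
    third-isThird {t} t<A = pick-isThird t<A
      (quotient-last (row₀ t A)) (quotient-last (row₁ t A)) (quotient-last (row₂ t A))
      where
      row₀ : ∀ t A → t ≡ t + 0 * A
      row₀ = solve-∀
      row₁ : ∀ t A → A + t ≡ t + 1 * A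
      row₁ = solve-∀
      row₂ : ∀ t A → A + A + t ≡ t + 2 * A
      row₂ = solve-∀

    open Count third third-isThird

    -- Coordinate sums of the third points, by the position of G relative to A

    U Z : ℕ
    U = ∑< A u₃
    Z = ∑< A z₃

    third-row₂ : ∀ {t} → A + t < G → third t ≡ (2 , (A + A + t) / G)
    third-row₂ {t} A+t<G = cong₂ (λ q₀ q₁ → pick q₀ q₁ ((A + A + t) / G))
      (m<n⇒m/n≡0 (≤-<-trans (m≤n+m t A) A+t<G)) (m<n⇒m/n≡0 A+t<G)

    -- Here row 0 has one point and row 1 at least two, so the third point is the last but one of
    -- row 1; hence the successor on `z₃ t`.
    third-row₁ : ∀ {t} → t < G → G ≤ A + t → u₃ t ≡ 1 × suc (z₃ t) ≡ (A + t) / G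
    third-row₁ {t} t<G G≤A+t rewrite m<n⇒m/n≡0 t<G
      with (A + t) / G | m≥n⇒m/n>0 G≤A+t
    ... | suc z | _ = refl , refl

    third-row₁′ : ∀ {s} → s < G → third (G + s) ≡ (1 , (A + (G + s)) / G)
    third-row₁′ {s} s<G = cong (λ q₀ → pick q₀ ((A + (G + s)) / G) ((A + A + (G + s)) / G))
      (trans ([G+n]/G s) (cong suc (m<n⇒m/n≡0 s<G)))

    third-row₀ : ∀ s → third (G + (G + s)) ≡ (0 , s / G)
    third-row₀ s = cong (λ q₀ → pick q₀ ((A + (G + (G + s))) / G) ((A + A + (G + (G + s))) / G))
      (trans ([G+n]/G (G + s)) (cong suc ([G+n]/G s)))

    -- A + t < G for every t < A, so rows 0 and 1 have one point each and all third points lie in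
    -- row 2.
    module _ (2A≤G : A + A ≤ G) where

      private
        A+t<G : ∀ {t} → t < A → A + t < G
        A+t<G t<A = <-≤-trans (+-monoʳ-< A t<A) 2A≤G

      U-2A≤G : U ≡ A * 2
      U-2A≤G = trans (∑<-cong A (cong proj₁ ∘ third-row₂ ∘ A+t<G)) (∑<-const A 2)

      Z-2A≤G : Z ≡ S (A + A + A)
      Z-2A≤G = begin
        Z                                               ≡⟨ ∑<-cong A (cong proj₂ ∘ third-row₂ ∘ A+t<G) ⟩
        ∑< A (λ t → (A + A + t) / G)                    ≡⟨ cong (_+ ∑< A (λ t → (A + A + t) / G)) (S-small 2A≤G) ⟨
        S (A + A) + ∑< A (λ t → (A + A + t) / G)        ≡⟨ S-shift (A + A) A ⟩
        S (A + A + A)                                   ∎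
        where open ≡-Reasoning

    -- Here h = G - A is the value of t at which A + t reaches G: below it the third point is in row
    -- 2, from it on in row 1.
    module _ {h k : ℕ} (A≡h+k : A ≡ h + k) (A+h≡G : A + h ≡ G) where

      private
        A≤G : A ≤ G
        A≤G = subst (A ≤_) A+h≡G (m≤m+n A h)

        k≤G : k ≤ G
        k≤G = ≤-trans (subst (k ≤_) (sym A≡h+k) (m≤n+m k h)) A≤G

        G+s≡A+h+s : ∀ s → G + s ≡ A + (h + s)
        G+s≡A+h+s s = trans (cong (_+ s) (sym A+h≡G)) (+-assoc A h s)

        low : ∀ {t} → t < h → A + t < G
        low t<h = subst (_ <_) A+h≡G (+-monoʳ-< A t<h)

        high : ∀ {s} → s < k → u₃ (h + s) ≡ 1 × suc (z₃ (h + s)) ≡ (A + (h + s)) / G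
        high {s} s<k = third-row₁
          (<-≤-trans (subst (h + s <_) (sym A≡h+k) (+-monoʳ-< h s<k)) A≤G)
          (subst (G ≤_) (G+s≡A+h+s s) (m≤m+n G s))

      U-A≤G≤2A : U ≡ h * 2 + k * 1
      U-A≤G≤2A = begin
        U                                            ≡⟨ cong (λ n → ∑< n u₃) A≡h+k ⟩
        ∑< (h + k) u₃                                ≡⟨ ∑<-split h k u₃ ⟩
        ∑< h u₃ + ∑< k (λ s → u₃ (h + s))            ≡⟨ cong₂ _+_ (∑<-cong h (cong proj₁ ∘ third-row₂ ∘ low)) (∑<-cong k (proj₁ ∘ high)) ⟩
        ∑< h (λ _ → 2) + ∑< k (λ _ → 1)              ≡⟨ cong₂ _+_ (∑<-const h 2) (∑<-const k 1) ⟩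
        h * 2 + k * 1                                ∎
        where open ≡-Reasoning

      -- For t < h the quotients sum to S (A + G) - S (2 A) = A - k = h. For the remaining t the
      -- quotient of row 1 is 1, and the last but one point has z = 0.
      Z-A≤G≤2A : Z ≡ h
      Z-A≤G≤2A = begin
        Z                                            ≡⟨ cong (λ n → ∑< n z₃) A≡h+k ⟩
        ∑< (h + k) z₃                                ≡⟨ ∑<-split h k z₃ ⟩
        ∑< h z₃ + ∑< k (λ s → z₃ (h + s))            ≡⟨ cong₂ _+_ lower upper ⟩
        h + 0                                        ≡⟨ +-identityʳ h ⟩
        h                                            ∎
        where
        open ≡-Reasoning
        2A≡G+k : A + A ≡ G + k
        2A≡G+k = trans (cong (A +_) A≡h+k) (sym (G+s≡A+h+s k))
        lower : ∑< h z₃ ≡ h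
        lower = +-cancelˡ-≡ k _ _ (begin
          k + ∑< h z₃
            ≡⟨ cong (k +_) (∑<-cong h (cong proj₂ ∘ third-row₂ ∘ low)) ⟩
          k + ∑< h (λ t → (A + A + t) / G)
            ≡⟨ cong (_+ ∑< h (λ t → (A + A + t) / G)) S2A ⟨
          S (A + A) + ∑< h (λ t → (A + A + t) / G)
            ≡⟨ S-shift (A + A) h ⟩
          S (A + A + h)
            ≡⟨ cong S (trans (+-assoc A A h) (trans (cong (A +_) A+h≡G) (+-comm A G))) ⟩
          S (G + A)
            ≡⟨ S-step A ⟩
          A + S A
            ≡⟨ cong₂ _+_ (trans A≡h+k (+-comm h k)) (S-small A≤G) ⟩
          k + h + 0
            ≡⟨ +-identityʳ (k + h) ⟩
          k + h ∎)
          where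
          S2A : S (A + A) ≡ k
          S2A = begin
            S (A + A)   ≡⟨ cong S 2A≡G+k ⟩
            S (G + k)   ≡⟨ S-step k ⟩
            k + S k     ≡⟨ cong (k +_) (S-small k≤G) ⟩
            k + 0       ≡⟨ +-identityʳ k ⟩
            k           ∎
        upper : ∑< k (λ s → z₃ (h + s)) ≡ 0
        upper = trans
          (∑<-cong k λ {s} s<k → suc-injective
            (trans (proj₂ (high s<k)) (trans (cong (_/ G) (sym (G+s≡A+h+s s))) ([G+n]/G s))))
          (S-small k≤G)

    module _ {n : ℕ} (A≡G+n : A ≡ G + n) where

      private
        first : ∀ {t} → t < G → u₃ t ≡ 1 × suc (z₃ t) ≡ (A + t) / G
        first {t} t<G = third-row₁ t<G
          (≤-trans (subst (G ≤_) (sym A≡G+n) (m≤m+n G n)) (m≤m+n A t))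

        ∑first : G + ∑< G z₃ ≡ ∑< G (λ t → (A + t) / G)
        ∑first = ∑<-suc z₃ (λ t → (A + t) / G) (proj₂ ∘ first)

      module _ (n≤G : n ≤ G) where

        U-G≤A≤2G : U ≡ A
        U-G≤A≤2G = begin
          U                                            ≡⟨ cong (λ n → ∑< n u₃) A≡G+n ⟩
          ∑< (G + n) u₃                                ≡⟨ ∑<-split G n u₃ ⟩
          ∑< G u₃ + ∑< n (λ s → u₃ (G + s))
            ≡⟨ cong₂ _+_ (∑<-cong G (proj₁ ∘ first)) (∑<-cong n λ s<n → cong proj₁ (third-row₁′ (<-≤-trans s<n n≤G))) ⟩
          ∑< G (λ _ → 1) + ∑< n (λ _ → 1)              ≡⟨ ∑<-split G n (λ _ → 1) ⟨
          ∑< (G + n) (λ _ → 1)                         ≡⟨ ∑<-const (G + n) 1 ⟩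
          (G + n) * 1                                  ≡⟨ *-identityʳ (G + n) ⟩
          G + n                                        ≡⟨ A≡G+n ⟨
          A                                            ∎
          where open ≡-Reasoning

        -- All third points lie in row 1. The quotients of that row sum to S (2 A) - S A, and each
        -- of the first G residues loses one because its third point is the last but one.
        Z-G≤A≤2G : S A + (G + Z) ≡ S (A + A)
        Z-G≤A≤2G = begin
          S A + (G + Z)
            ≡⟨ cong (λ n → S A + (G + ∑< n z₃)) A≡G+n ⟩
          S A + (G + ∑< (G + n) z₃)
            ≡⟨ cong (λ e → S A + (G + e)) (∑<-split G n z₃) ⟩
          S A + (G + (∑< G z₃ + ∑< n (λ s → z₃ (G + s))))
            ≡⟨ cong (S A +_) (+-assoc G _ _) ⟨
          S A + (G + ∑< G z₃ + ∑< n (λ s → z₃ (G + s)))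
            ≡⟨ cong (S A +_) (cong₂ _+_ ∑first (∑<-cong n λ s<n → cong proj₂ (third-row₁′ (<-≤-trans s<n n≤G)))) ⟩
          S A + (∑< G (λ t → (A + t) / G) + ∑< n (λ s → (A + (G + s)) / G))
            ≡⟨ cong (S A +_) (∑<-split G n (λ t → (A + t) / G)) ⟨
          S A + ∑< (G + n) (λ t → (A + t) / G)
            ≡⟨ S-shift A (G + n) ⟩
          S (A + (G + n))
            ≡⟨ cong (λ n → S (A + n)) A≡G+n ⟨
          S (A + A) ∎
          where open ≡-Reasoning

      -- Now A = 2 G + k, and the residues split into three blocks: last but one of row 1 for t < G,
      -- last of row 1 for G ≤ t < 2 G, and two before the last of row 0 from 2 G on.
      module _ {k : ℕ} (n≡G+k : n ≡ G + k) where

        private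
          A≡2G+k : A ≡ (G + G) + k
          A≡2G+k = trans A≡G+n (trans (cong (G +_) n≡G+k) (sym (+-assoc G G k)))

          split : ∀ f → ∑< A f ≡ ∑< G f + ∑< G (λ s → f (G + s)) + ∑< k (λ s → f (G + (G + s)))
          split f = begin
            ∑< A f                                       ≡⟨ cong (λ n → ∑< n f) A≡2G+k ⟩
            ∑< ((G + G) + k) f                           ≡⟨ ∑<-split (G + G) k f ⟩
            ∑< (G + G) f + ∑< k (λ s → f (G + G + s))
              ≡⟨ cong₂ _+_ (∑<-split G G f) (∑<-cong k λ {s} _ → cong f (+-assoc G G s)) ⟩
            ∑< G f + ∑< G (λ s → f (G + s)) + ∑< k (λ s → f (G + (G + s))) ∎
            where open ≡-Reasoning

        U-2G≤A : U ≡ G * 1 + G * 1 + k * 0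
        U-2G≤A = trans (split u₃) (cong₂ _+_ (cong₂ _+_
          (trans (∑<-cong G (proj₁ ∘ first)) (∑<-const G 1))
          (trans (∑<-cong G (cong proj₁ ∘ third-row₁′)) (∑<-const G 1)))
          (trans (∑<-cong k λ {s} _ → cong proj₁ (third-row₀ s)) (∑<-const k 0)))

        Z-2G≤A : Z ≡ A + A + S k
        Z-2G≤A = +-cancelˡ-≡ (S A + G) _ _ (begin
          S A + G + Z
            ≡⟨ cong (S A + G +_) (split z₃) ⟩
          S A + G + (∑< G z₃ + ∑< G (λ s → z₃ (G + s)) + ∑< k (λ s → z₃ (G + (G + s))))
            ≡⟨ regroup₁ (S A) G (∑< G z₃) _ _ ⟩
          S A + (G + ∑< G z₃ + ∑< G (λ s → z₃ (G + s))) + ∑< k (λ s → z₃ (G + (G + s)))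
            ≡⟨ cong₂ (λ x y → S A + x + y)
                 (cong₂ _+_ ∑first (∑<-cong G (cong proj₂ ∘ third-row₁′)))
                 (∑<-cong k λ {s} _ → cong proj₂ (third-row₀ s)) ⟩
          S A + (∑< G (λ t → (A + t) / G) + ∑< G (λ s → (A + (G + s)) / G)) + S k
            ≡⟨ cong (λ x → S A + x + S k) (∑<-split G G (λ t → (A + t) / G)) ⟨
          S A + ∑< (G + G) (λ t → (A + t) / G) + S k
            ≡⟨ cong (_+ S k) (S-shift A (G + G)) ⟩
          S (A + (G + G)) + S k
            ≡⟨ cong (λ n → S n + S k) (swap A G) ⟩
          S (G + (G + A)) + S k
            ≡⟨ cong (_+ S k) (trans (S-step (G + A)) (cong (G + A +_) (S-step A))) ⟩
          G + A + (A + S A) + S k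
            ≡⟨ regroup₂ G A (S A) (S k) ⟩
          S A + G + (A + A + S k) ∎)
          where
          open ≡-Reasoning
          regroup₁ : ∀ a g x y z → a + g + (x + y + z) ≡ a + (g + x + y) + z
          regroup₁ = solve-∀
          regroup₂ : ∀ g a x y → g + a + (a + x) + y ≡ x + g + (a + a + y)
          regroup₂ = solve-∀
          swap : ∀ a g → a + (g + g) ≡ g + (g + a)
          swap = solve-∀

    gcd≡1 : gcd A (gcd B (gcd C 0)) ≡ 1
    gcd≡1 = A⊥B (gcd[m,n]∣m A _ , ∣-trans (gcd[m,n]∣n A _) (gcd[m,n]∣m B _))

    counted : ∀ {u z} → U ≡ u → Z ≡ z → Counted A B C H u z
    counted refl refl = record
      { isSylvesterNumber = record { positive = positive ; coprime = gcd≡1 ; count = count }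
      ; total             = total }
      where
      open ≡-Reasoning
      regroup₁ : ∀ x y a b → 2 * x + 2 * y + a + b ≡ 2 * (x + y) + a + b
      regroup₁ = solve-∀
      regroup₂ : ∀ x y a b → 2 * (x + y) + a + b ≡ 2 * x + a + b + 2 * y
      regroup₂ = solve-∀
      total : 2 * ∑< A w + 2 * (H * Z) + A + B ≡ A * B + 1 + 2 * (B * U)
      total = begin
        2 * ∑< A w + 2 * (H * Z) + A + B       ≡⟨ regroup₁ (∑< A w) (H * Z) A B ⟩
        2 * (∑< A w + H * Z) + A + B           ≡⟨ cong (λ e → 2 * e + A + B) ∑w ⟩
        2 * (∑< A φ + B * U) + A + B           ≡⟨ regroup₂ (∑< A φ) (B * U) A B ⟩
        2 * ∑< A φ + A + B + 2 * (B * U)       ≡⟨ cong (_+ 2 * (B * U)) 2∑φ ⟩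
        A * B + 1 + 2 * (B * U)                ∎

    counted-3A≤G : A + A + A ≤ G → Counted A B C H (A * 2) 0
    counted-3A≤G 3A≤G = counted (U-2A≤G 2A≤G) (trans (Z-2A≤G 2A≤G) (S-small 3A≤G))
      where
      2A≤G : A + A ≤ G
      2A≤G = ≤-trans (m≤m+n (A + A) A) 3A≤G

    counted-2A≤G≤3A : ∀ {n} → A + A ≤ G → A + A + A ≡ G + n → n ≤ G → Counted A B C H (A * 2) n
    counted-2A≤G≤3A {n} 2A≤G 3A≡G+n n≤G = counted (U-2A≤G 2A≤G) (begin
      Z               ≡⟨ Z-2A≤G 2A≤G ⟩
      S (A + A + A)   ≡⟨ cong S 3A≡G+n ⟩
      S (G + n)       ≡⟨ S-step n ⟩
      n + S n         ≡⟨ cong (n +_) (S-small n≤G) ⟩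
      n + 0           ≡⟨ +-identityʳ n ⟩
      n               ∎)
      where open ≡-Reasoning

    counted-A≤G≤2A : ∀ {h k} → A ≡ h + k → A + h ≡ G → Counted A B C H (h * 2 + k * 1) h
    counted-A≤G≤2A A≡h+k A+h≡G = counted (U-A≤G≤2A A≡h+k A+h≡G) (Z-A≤G≤2A A≡h+k A+h≡G)

    counted-A≡G : A ≡ G → Counted A B C H A 0
    counted-A≡G A≡G = counted (U-G≤A≤2G A≡G+0 z≤n) (+-cancelˡ-≡ (S A + G) Z 0 (begin
      S A + G + Z     ≡⟨ +-assoc (S A) G Z ⟩
      S A + (G + Z)   ≡⟨ Z-G≤A≤2G A≡G+0 z≤n ⟩
      S (A + A)       ≡⟨ cong (λ n → S (n + A)) A≡G ⟩
      S (G + A)       ≡⟨ S-step A ⟩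
      A + S A         ≡⟨ cong (_+ S A) A≡G ⟩
      G + S A         ≡⟨ +-comm G (S A) ⟩
      S A + G         ≡⟨ +-identityʳ (S A + G) ⟨
      S A + G + 0     ∎))
      where
      open ≡-Reasoning
      A≡G+0 : A ≡ G + 0
      A≡G+0 = trans A≡G (sym (+-identityʳ G))

    -- The bounds on n and m make the quotient sums explicit: S A = A - G and S (2 A) = 3 G + 3 m =
    -- 6 A - 6 G. Then Z = S (2 A) - S A - G = 5 A - 6 G.
    counted-3G≤2A≤4G : ∀ {n m} → A ≡ G + n → n ≤ G → A + A ≡ G + (G + (G + m)) → m ≤ G →
      ∃ λ z → z + 6 * G ≡ 5 * A × Counted A B C H A z
    counted-3G≤2A≤4G {n} {m} A≡G+n n≤G 2A≡3G+m m≤G =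
      Z , Z+6G≡5A , counted (U-G≤A≤2G A≡G+n n≤G) refl
      where
      open ≡-Reasoning
      SA≡n : S A ≡ n
      SA≡n = begin
        S A             ≡⟨ cong S A≡G+n ⟩
        S (G + n)       ≡⟨ S-step n ⟩
        n + S n         ≡⟨ cong (n +_) (S-small n≤G) ⟩
        n + 0           ≡⟨ +-identityʳ n ⟩
        n               ∎
      S2A≡3G+3m : S (A + A) ≡ (G + (G + m)) + ((G + m) + (m + 0))
      S2A≡3G+3m = begin
        S (A + A)                                   ≡⟨ cong S 2A≡3G+m ⟩
        S (G + (G + (G + m)))                       ≡⟨ S-step (G + (G + m)) ⟩
        (G + (G + m)) + S (G + (G + m))             ≡⟨ cong (λ e → (G + (G + m)) + e) (S-step (G + m)) ⟩
        (G + (G + m)) + ((G + m) + S (G + m))       ≡⟨ cong (λ e → (G + (G + m)) + ((G + m) + e)) (S-step m) ⟩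
        (G + (G + m)) + ((G + m) + (m + S m))       ≡⟨ cong (λ e → (G + (G + m)) + ((G + m) + (m + e))) (S-small m≤G) ⟩
        (G + (G + m)) + ((G + m) + (m + 0))         ∎
      Z+6G≡5A : Z + 6 * G ≡ 5 * A
      Z+6G≡5A = +-cancelʳ-≡ A _ _ (begin
        Z + 6 * G + A
          ≡⟨ cong (Z + 6 * G +_) A≡G+n ⟩
        Z + 6 * G + (G + n)
          ≡⟨ regroup₁ Z G n ⟩
        n + (G + Z) + 6 * G
          ≡⟨ cong (λ e → e + (G + Z) + 6 * G) SA≡n ⟨
        S A + (G + Z) + 6 * G
          ≡⟨ cong (_+ 6 * G) (trans (Z-G≤A≤2G A≡G+n n≤G) S2A≡3G+3m) ⟩
        (G + (G + m)) + ((G + m) + (m + 0)) + 6 * G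
          ≡⟨ regroup₂ G m ⟩
        3 * (G + (G + (G + m)))
          ≡⟨ cong (3 *_) 2A≡3G+m ⟨
        3 * (A + A)
          ≡⟨ regroup₃ A ⟩
        5 * A + A ∎)
        where
        regroup₁ : ∀ Z G n → Z + 6 * G + (G + n) ≡ n + (G + Z) + 6 * G
        regroup₁ = solve-∀
        regroup₂ : ∀ G m → (G + (G + m)) + ((G + m) + (m + 0)) + 6 * G ≡ 3 * (G + (G + (G + m)))
        regroup₂ = solve-∀
        regroup₃ : ∀ A → 3 * (A + A) ≡ 5 * A + A
        regroup₃ = solve-∀

    -- The quotient is 2 + r: the first 2 G residues have their third point in row 1, which gives u
    -- = 2 G, and the other m + r G contribute a sum evaluated by `2S`.
    counted-2G≤A : ∀ {m} r → A ≡ m + (2 + r) * G → m ≤ G →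
      ∃ λ z → 2 * z + G * (r * suc r) ≡ 4 * A + 2 * (r * (m + r * G)) × Counted A B C H (2 * G) z
    counted-2G≤A {m} r A≡ m≤G =
      A + A + S k , 2Z , counted (trans (U-2G≤A A≡2G+k refl) (regroup₁ G k)) (Z-2G≤A A≡2G+k refl)
      where
      open ≡-Reasoning
      k = m + r * G
      regroup₁ : ∀ G k → G * 1 + G * 1 + k * 0 ≡ 2 * G
      regroup₁ = solve-∀
      A≡2G+k : A ≡ G + (G + k)
      A≡2G+k = trans A≡ (regroup m r G)
        where
        regroup : ∀ m r G → m + (2 + r) * G ≡ G + (G + (m + r * G))
        regroup = solve-∀
      2Z : 2 * (A + A + S k) + G * (r * suc r) ≡ 4 * A + 2 * (r * k)
      2Z = begin
        2 * (A + A + S k) + G * (r * suc r)         ≡⟨ regroup A (S k) (G * (r * suc r)) ⟩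
        4 * A + (2 * S k + G * (r * suc r))         ≡⟨ cong (4 * A +_) (2S r m≤G) ⟩
        4 * A + 2 * (r * k)                         ∎
        where
        regroup : ∀ a s x → 2 * (a + a + s) + x ≡ 4 * a + (2 * s + x)
        regroup = solve-∀

  open import Data.Integer.Base using (ℤ; +_)

  -- Passing to ℤ and ℚ

  /2-cong : ∀ {m x} → + 2 ℤ.* + m ≡ x → + m ℚ./ 1 ≡ x ℚ./ 2
  /2-cong {m} {x} eq = ℚ.fromℚᵘ-cong {mkℚᵘ (+ m) 0} {mkℚᵘ x 1}
    (*≡* (trans (ℤ.*-comm (+ m) (+ 2)) (trans eq (sym (ℤ.*-identityʳ x)))))

  -- Case (f) is stated as a difference of two halves. Halves in ℚ are normalised, so the equation
  -- is checked on unnormalised fractions.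
  /2-distrib-- : ∀ x y → (x ℤ.- y) ℚ./ 2 ≡ x ℚ./ 2 ℚ.- y ℚ./ 2
  /2-distrib-- x y = sym (ℚ.toℚᵘ-injective (begin
    ℚ.toℚᵘ (x ℚ./ 2 ℚ.- y ℚ./ 2)
      ≈⟨ ℚ.toℚᵘ-homo-+ (x ℚ./ 2) (ℚ.- (y ℚ./ 2)) ⟩
    ℚ.toℚᵘ (x ℚ./ 2) ℚᵘ.+ ℚ.toℚᵘ (ℚ.- (y ℚ./ 2))
      ≈⟨ ℚᵘ.+-cong (ℚ.toℚᵘ-fromℚᵘ (mkℚᵘ x 1)) (ℚᵘ.≃-trans (ℚ.toℚᵘ-homo‿- (y ℚ./ 2)) (ℚᵘ.-‿cong (ℚ.toℚᵘ-fromℚᵘ (mkℚᵘ y 1)))) ⟩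
    mkℚᵘ x 1 ℚᵘ.- mkℚᵘ y 1
      ≈⟨ *≡* (common x y) ⟩
    mkℚᵘ (x ℤ.- y) 1
      ≈⟨ ℚ.toℚᵘ-fromℚᵘ (mkℚᵘ (x ℤ.- y) 1) ⟨
    ℚ.toℚᵘ ((x ℤ.- y) ℚ./ 2) ∎))
    where
    open import Relation.Binary.Reasoning.Setoid ℚᵘ.≃-setoid
    common : ∀ x y → (x ℤ.* + 2 ℤ.+ (ℤ.- y) ℤ.* + 2) ℤ.* + 2 ≡ (x ℤ.- y) ℤ.* + 4
    common = solve-∀ℤ

  x+y≡z⇒x≡z-y : ∀ {x y z} → x + y ≡ z → + x ≡ + z ℤ.- + y
  x+y≡z⇒x≡z-y {x} {y} refl = trans (cancel (+ x) (+ y)) (cong (ℤ._- + y) (sym (ℤ.pos-+ x y)))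
    where
    cancel : ∀ x y → x ≡ x ℤ.+ y ℤ.- y
    cancel = solve-∀ℤ

  -- The factor 2 stays with z because case (f) supplies a polynomial for 2 z only.
  count-in-ℤ : ∀ m h z a b u → 2 * m + 2 * (h * z) + a + b ≡ a * b + 1 + 2 * (b * u) →
    + 2 ℤ.* + m ≡
      + a ℤ.* + b ℤ.- + a ℤ.- + b ℤ.+ + 1 ℤ.+ + 2 ℤ.* (+ b ℤ.* + u) ℤ.- + h ℤ.* (+ 2 ℤ.* + z)
  count-in-ℤ m h z a b u eq = begin
    + 2 ℤ.* + m
      ≡⟨ ℤ.pos-* 2 m ⟨
    + (2 * m)
      ≡⟨ x+y≡z⇒x≡z-y (trans (regroup (2 * m) (2 * (h * z)) a b) eq) ⟩
    + (a * b + 1 + 2 * (b * u)) ℤ.- + (2 * (h * z) + a + b)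
      ≡⟨ cong₂ ℤ._-_ left right ⟩
    + a ℤ.* + b ℤ.+ + 1 ℤ.+ + 2 ℤ.* (+ b ℤ.* + u) ℤ.- (+ 2 ℤ.* (+ h ℤ.* + z) ℤ.+ + a ℤ.+ + b)
      ≡⟨ rearrange (+ h) (+ z) (+ a) (+ b) (+ u) ⟩
    + a ℤ.* + b ℤ.- + a ℤ.- + b ℤ.+ + 1 ℤ.+ + 2 ℤ.* (+ b ℤ.* + u) ℤ.- + h ℤ.* (+ 2 ℤ.* + z) ∎
    where
    open ≡-Reasoning
    regroup : ∀ x y a b → x + (y + a + b) ≡ x + y + a + b
    regroup = solve-∀
    left : + (a * b + 1 + 2 * (b * u)) ≡ + a ℤ.* + b ℤ.+ + 1 ℤ.+ + 2 ℤ.* (+ b ℤ.* + u)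
    left = cong₂ (λ x y → x ℤ.+ + 1 ℤ.+ y) (ℤ.pos-* a b) (trans (ℤ.pos-* 2 (b * u)) (cong (+ 2 ℤ.*_) (ℤ.pos-* b u)))
    right : + (2 * (h * z) + a + b) ≡ + 2 ℤ.* (+ h ℤ.* + z) ℤ.+ + a ℤ.+ + b
    right = cong (λ x → x ℤ.+ + a ℤ.+ + b) (trans (ℤ.pos-* 2 (h * z)) (cong (+ 2 ℤ.*_) (ℤ.pos-* h z)))
    rearrange : ∀ h z a b u →
      a ℤ.* b ℤ.+ + 1 ℤ.+ + 2 ℤ.* (b ℤ.* u) ℤ.- (+ 2 ℤ.* (h ℤ.* z) ℤ.+ a ℤ.+ b)
      ≡ a ℤ.* b ℤ.- a ℤ.- b ℤ.+ + 1 ℤ.+ + 2 ℤ.* (b ℤ.* u) ℤ.- h ℤ.* (+ 2 ℤ.* z)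
    rearrange = solve-∀ℤ

  -- Fibonacci numbers

  F-≤-suc : ∀ n → F n ≤ F (suc n)
  F-≤-suc zero    = z≤n
  F-≤-suc (suc n) = m≤m+n (F (suc n)) (F n)

  F-mono-≤ : ∀ {m n} → m ≤ n → F m ≤ F n
  F-mono-≤ {m} m≤n with e , refl ← m≤n⇒∃[o]m+o≡n m≤n = go e
    where
    go : ∀ e → F m ≤ F (m + e)
    go zero    = ≤-reflexive (cong F (sym (+-identityʳ m)))
    go (suc e) = ≤-trans (go e) (≤-trans (F-≤-suc (m + e)) (≤-reflexive (cong F (sym (+-suc m e)))))

  F-coprime-suc : ∀ n → Coprime (F n) (F (suc n))
  F-coprime-suc zero    (_ , p) = ∣1⇒≡1 p
  F-coprime-suc (suc n) (p , q) = F-coprime-suc n (∣m+n∣m⇒∣n q p , p)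

  F[n+2] : ∀ n → F (n + 2) ≡ F (suc n) + F n
  F[n+2] n = cong F (+-comm n 2)

  F-coprime-+2 : ∀ n → Coprime (F n) (F (n + 2))
  F-coprime-+2 n {d} (p , q) =
    F-coprime-suc n (p , ∣m+n∣m⇒∣n (subst (d ∣_) (trans (F[n+2] n) (+-comm _ (F n))) q) p)

  -- Both sides satisfy the Fibonacci recurrence in k, so two initial values suffice. This is the
  -- relation C + A H = B G.
  F-addition : ∀ n k → F (n + (2 + k)) + F n * F k ≡ F (n + 2) * F (2 + k)
  F-addition n zero = begin
    F (n + 2) + F n * 0  ≡⟨ cong (λ e → F (n + 2) + e) (*-zeroʳ (F n)) ⟩
    F (n + 2) + 0        ≡⟨ +-identityʳ _ ⟩
    F (n + 2)            ≡⟨ *-identityʳ _ ⟨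
    F (n + 2) * 1        ∎
    where open ≡-Reasoning
  F-addition n (suc zero) = begin
    F (n + 3) + F n * 1                    ≡⟨ cong (λ e → F e + F n * 1) (+-comm n 3) ⟩
    F (suc n) + F n + F (suc n) + F n * 1  ≡⟨ regroup (F n) (F (suc n)) ⟩
    (F (suc n) + F n) * 2                  ≡⟨ cong (_* 2) (F[n+2] n) ⟨
    F (n + 2) * 2                          ∎
    where
    open ≡-Reasoning
    regroup : ∀ x y → y + x + y + x * 1 ≡ (y + x) * 2
    regroup = solve-∀
  F-addition n (suc (suc k)) = begin
    F (n + (4 + k)) + F n * (F (suc k) + F k)
      ≡⟨ cong (_+ F n * (F (suc k) + F k)) recurrence ⟩
    F (n + (3 + k)) + F (n + (2 + k)) + F n * (F (suc k) + F k)
      ≡⟨ regroup (F (n + (3 + k))) (F (n + (2 + k))) (F n) (F (suc k)) (F k) ⟩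
    (F (n + (3 + k)) + F n * F (suc k)) + (F (n + (2 + k)) + F n * F k)
      ≡⟨ cong₂ _+_ (F-addition n (suc k)) (F-addition n k) ⟩
    F (n + 2) * F (3 + k) + F (n + 2) * F (2 + k)
      ≡⟨ *-distribˡ-+ (F (n + 2)) (F (3 + k)) (F (2 + k)) ⟨
    F (n + 2) * F (4 + k) ∎
    where
    open ≡-Reasoning
    recurrence : F (n + (4 + k)) ≡ F (n + (3 + k)) + F (n + (2 + k))
    recurrence = begin
      F (n + (4 + k))                         ≡⟨ cong F (trans (+-suc n (3 + k)) (cong suc (+-suc n (2 + k)))) ⟩
      F (suc (n + (2 + k))) + F (n + (2 + k)) ≡⟨ cong (λ e → F e + F (n + (2 + k))) (+-suc n (2 + k)) ⟨
      F (n + (3 + k)) + F (n + (2 + k))       ∎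
    regroup : ∀ x y a b c → x + y + a * (b + c) ≡ (x + a * b) + (y + a * c)
    regroup = solve-∀

  2F≤F[2+n] : ∀ n → 2 * F n ≤ F (2 + n)
  2F≤F[2+n] n = subst (_≤ F (2 + n)) (cong (λ e → F n + e) (sym (+-identityʳ (F n)))) (+-monoˡ-≤ (F n) (F-≤-suc n))

  -- The difference of the two sides is exactly F (n - 3).
  5F≤2F[n+2] : ∀ {n} → 3 ≤ n → 5 * F n ≤ 2 * F (n + 2)
  5F≤2F[n+2] {n@(suc (suc (suc j)))} (s≤s (s≤s (s≤s _))) = begin
    5 * (b + a + b)                               ≤⟨ m≤m+n _ a ⟩
    5 * (b + a + b) + a                           ≡⟨ regroup a b ⟩
    2 * (b + a + b + (b + a) + (b + a + b))       ≡⟨ cong (2 *_) (F[n+2] n) ⟨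
    2 * F (n + 2)                                 ∎
    where
    open ≤-Reasoning
    a = F j
    b = F (suc j)
    regroup : ∀ a b → 5 * (b + a + b) + a ≡ 2 * (b + a + b + (b + a) + (b + a + b))
    regroup = solve-∀

  admissible : ∀ {i c} k → 3 ≤ i → c ≡ i + (2 + k) → Admissible (F i) (F (i + 2)) (F c) (F (2 + k)) (F k)
  admissible {i} {c} k i≥3 c≡ = record
    { A≢0     = F-nonZero (≤-trans (s≤s z≤n) i≥3)
    ; B≢0     = F-nonZero (≤-trans (s≤s z≤n) (m≤n+m 2 i))
    ; C≢0     = F-nonZero (subst (1 ≤_) (sym c≡) (≤-trans (s≤s z≤n) (m≤n+m (2 + k) i)))
    ; G≢0     = F-nonZero {2 + k} (s≤s z≤n)
    ; A⊥B     = F-coprime-+2 i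
    ; C+AH≡BG = trans (cong (λ e → F e + F i * F k) c≡) (F-addition i k)
    ; 2H≤G    = 2F≤F[2+n] k
    ; 5A≤2B   = 5F≤2F[n+2] i≥3
    }

  -- The six cases

  -- The primed variables and `w` let a case replace H, u and 2 z by integer expressions, so that
  -- only a polynomial identity remains to be checked.
  counted⇒≐ : ∀ {a b c h u z h′ u′ w x} → Counted a b c h u z →
    + h ≡ h′ → + u ≡ u′ → + 2 ℤ.* + z ≡ w →
    + a ℤ.* + b ℤ.- + a ℤ.- + b ℤ.+ + 1 ℤ.+ + 2 ℤ.* (+ b ℤ.* u′) ℤ.- h′ ℤ.* w ≡ x →
    n[ 2 ] (a ∷ b ∷ c ∷ []) ≐ x ℚ./ 2
  counted⇒≐ {a} {b} {h = h} {u} {z} counted refl refl refl eq =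
    m , isSylvesterNumber , /2-cong {m} (trans (count-in-ℤ m h z a b u total) eq)
    where open Counted counted

  case-a : ∀ {i k} → 3 ≤ i → i + 3 ≤ k →
    n[ 2 ] (F i ∷ F (i + 2) ∷ F (i + k) ∷ [])
      ≐ (+ 5 ℤ.* + F i ℤ.* + F (i + 2) ℤ.- + F i ℤ.- + F (i + 2) ℤ.+ + 1) ℚ./ 2
  case-a {i} {k} i≥3 i+3≤k
    with l , refl ← m≤n⇒∃[o]m+o≡n (≤-trans (≤-trans (s≤s (s≤s z≤n)) (m≤n+m 3 i)) i+3≤k) =
    counted⇒≐ (Third.counted-3A≤G (admissible l i≥3 refl) 3A≤G)
      refl (ℤ.pos-* (F i) 2) refl (simplify (+ F i) (+ F (i + 2)) (+ F l))
    where
    3A≤G : F i + F i + F i ≤ F k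
    3A≤G = begin
      F i + F i + F i          ≤⟨ +-mono-≤ (+-monoˡ-≤ (F i) (F-≤-suc i)) (F-≤-suc i) ⟩
      F (3 + i)                ≡⟨ cong F (+-comm 3 i) ⟩
      F (i + 3)                ≤⟨ F-mono-≤ i+3≤k ⟩
      F k                      ∎
      where open ≤-Reasoning
    simplify : ∀ a b h → a ℤ.* b ℤ.- a ℤ.- b ℤ.+ + 1 ℤ.+ + 2 ℤ.* (b ℤ.* (a ℤ.* + 2)) ℤ.- h ℤ.* + 0
      ≡ + 5 ℤ.* a ℤ.* b ℤ.- a ℤ.- b ℤ.+ + 1
    simplify = solve-∀ℤ

  case-b : ∀ {i} → 3 ≤ i →
    n[ 2 ] (F i ∷ F (i + 2) ∷ F (2 * i + 2) ∷ [])
      ≐ ((+ 7 ℤ.* + F (i + 2) ℤ.- + 6 ℤ.* + F i ℤ.- + 1) ℤ.* + F i ℤ.- + F (i + 2) ℤ.+ + 1) ℚ./ 2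
  case-b {i@(suc i-1)} i≥3 =
    -- Here k = i + 2, so G is B and H is A, and the sum of the z is 3 A - B.
    counted⇒≐ (Third.counted-2A≤G≤3A (admissible i i≥3 (index i)) 2A≤G (sym (m+[n∸m]≡n G≤3A)) n≤G)
      refl (ℤ.pos-* A 2) (cong (+ 2 ℤ.*_) n≡) (simplify (+ A) (+ B))
    where
    A B G : ℕ
    A = F i
    B = F (i + 2)
    G = F (2 + i)
    index : ∀ i → 2 * i + 2 ≡ i + (2 + i)
    index = solve-∀
    2A≤G : A + A ≤ G
    2A≤G = +-monoˡ-≤ A (F-≤-suc i)
    G≤3A : G ≤ A + A + A
    G≤3A = +-monoˡ-≤ A (+-monoʳ-≤ A (F-≤-suc i-1))
    n≤G : A + A + A ∸ G ≤ G
    n≤G = m≤n+o⇒m∸n≤o _ G (+-mono-≤ 2A≤G (≤-trans (m≤m+n A A) 2A≤G))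
    n≡ : + (A + A + A ∸ G) ≡ + A ℤ.+ + A ℤ.+ + A ℤ.- + B
    n≡ = trans (x+y≡z⇒x≡z-y {y = G} (m∸n+n≡m G≤3A)) (cong (λ e → + A ℤ.+ + A ℤ.+ + A ℤ.- + F e) (+-comm 2 i))
    simplify : ∀ a b →
      a ℤ.* b ℤ.- a ℤ.- b ℤ.+ + 1 ℤ.+ + 2 ℤ.* (b ℤ.* (a ℤ.* + 2)) ℤ.- a ℤ.* (+ 2 ℤ.* (a ℤ.+ a ℤ.+ a ℤ.- b))
      ≡ (+ 7 ℤ.* b ℤ.- + 6 ℤ.* a ℤ.- + 1) ℤ.* a ℤ.- b ℤ.+ + 1
    simplify = solve-∀ℤ

  case-c : ∀ {i} → 3 ≤ i →
    n[ 2 ] (F i ∷ F (i + 2) ∷ F (2 * i + 1) ∷ [])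
      ≐ ((+ 7 ℤ.* + F (i + 2) ℤ.- + 8 ℤ.* + F i ℤ.- + 1) ℤ.* + F i ℤ.- + F (i + 2) ℤ.+ + 1) ℚ./ 2
  case-c {i@(suc (suc l))} i≥3@(s≤s (s≤s _)) =
    -- Here k = i + 1, so G - A = F (i - 1), which is also H: both H and the sum of the z become B -
    -- 2 A.
    counted⇒≐ (Third.counted-A≤G≤2A (admissible (suc l) i≥3 (index l)) refl refl)
      h≡ u≡ (cong (+ 2 ℤ.*_) h≡) (simplify (+ A) (+ B))
    where
    A B h k : ℕ
    A = F i
    B = F (i + 2)
    h = F (suc l)
    k = F l
    index : ∀ l → 2 * (2 + l) + 1 ≡ 2 + l + (2 + suc l)
    index = solve-∀
    h≡ : + h ≡ + B ℤ.- (+ A ℤ.+ + A)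
    h≡ = x+y≡z⇒x≡z-y {y = A + A} (trans (regroup h A) (sym (F[n+2] i)))
      where
      regroup : ∀ h a → h + (a + a) ≡ a + h + a
      regroup = solve-∀
    u≡ : + (h * 2 + k * 1) ≡ + B ℤ.- + A
    u≡ = x+y≡z⇒x≡z-y {y = A} (trans (regroup h k) (sym (F[n+2] i)))
      where
      regroup : ∀ h k → h * 2 + k * 1 + (h + k) ≡ h + k + h + (h + k)
      regroup = solve-∀
    simplify : ∀ a b →
      a ℤ.* b ℤ.- a ℤ.- b ℤ.+ + 1 ℤ.+ + 2 ℤ.* (b ℤ.* (b ℤ.- a)) ℤ.- (b ℤ.- (a ℤ.+ a)) ℤ.* (+ 2 ℤ.* (b ℤ.- (a ℤ.+ a)))
      ≡ (+ 7 ℤ.* b ℤ.- + 8 ℤ.* a ℤ.- + 1) ℤ.* a ℤ.- b ℤ.+ + 1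
    simplify = solve-∀ℤ

  case-d : ∀ {i} → 3 ≤ i →
    n[ 2 ] (F i ∷ F (i + 2) ∷ F (2 * i) ∷ [])
      ≐ (+ 3 ℤ.* + F i ℤ.* + F (i + 2) ℤ.- + F i ℤ.- + F (i + 2) ℤ.+ + 1) ℚ./ 2
  case-d {i@(suc (suc l))} i≥3@(s≤s (s≤s _)) =
    counted⇒≐ (Third.counted-A≡G (admissible l i≥3 (cong (λ e → i + e) (+-identityʳ i))) refl)
      refl refl refl (simplify (+ F i) (+ F (i + 2)) (+ F l))
    where
    simplify : ∀ a b h → a ℤ.* b ℤ.- a ℤ.- b ℤ.+ + 1 ℤ.+ + 2 ℤ.* (b ℤ.* a) ℤ.- h ℤ.* + 0
      ≡ + 3 ℤ.* a ℤ.* b ℤ.- a ℤ.- b ℤ.+ + 1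
    simplify = solve-∀ℤ

  case-e : ∀ {i} → 3 ≤ i →
    n[ 2 ] (F i ∷ F (i + 2) ∷ F (2 * i ∸ 1) ∷ [])
      ≐ ((+ 170 ℤ.* + F i ℤ.- + 1) ℤ.* + F i
          ℤ.+ (+ 24 ℤ.* + F (i + 2) ℤ.- + 125 ℤ.* + F i ℤ.- + 1) ℤ.* + F (i + 2) ℤ.+ + 1) ℚ./ 2
  case-e {i@(suc (suc (suc l)))} i≥3@(s≤s (s≤s (s≤s _))) =
    -- Here k = i - 1. With a = F (i - 3) and b = F (i - 2), A = 2 b + a and G = b + a, whence 2 A =
    -- 3 G + (b - a).
    evaluate (Third.counted-3G≤2A≤4G (admissible l i≥3 (index l))
      {n = b} {m = b ∸ a} refl (m≤m+n b a) 2A≡3G+m (≤-trans (m∸n≤m b a) (m≤m+n b a)))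
    where
    A B G a b : ℕ
    A = F i
    B = F (i + 2)
    G = F (2 + l)
    a = F l
    b = F (suc l)
    index : ∀ l → 2 + l + (3 + l + 0) ≡ 3 + l + (2 + l)
    index = solve-∀
    2A≡3G+m : A + A ≡ G + (G + (G + (b ∸ a)))
    2A≡3G+m = begin
      b + a + b + (b + a + b)                      ≡⟨ regroup₁ a b ⟩
      3 * b + 2 * a + b                            ≡⟨ cong (λ e → 3 * b + 2 * a + e) (m+[n∸m]≡n (F-≤-suc l)) ⟨
      3 * b + 2 * a + (a + (b ∸ a))                ≡⟨ regroup₂ a b (b ∸ a) ⟩
      G + (G + (G + (b ∸ a)))                      ∎
      where
      open ≡-Reasoning
      regroup₁ : ∀ a b → b + a + b + (b + a + b) ≡ 3 * b + 2 * a + b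
      regroup₁ = solve-∀
      regroup₂ : ∀ a b m → 3 * b + 2 * a + (a + m) ≡ b + a + (b + a + (b + a + m))
      regroup₂ = solve-∀
    h≡ : + a ≡ + 2 ℤ.* + B ℤ.- + 5 ℤ.* + A
    h≡ = trans (x+y≡z⇒x≡z-y (begin
      a + 5 * A              ≡⟨ regroup a b ⟩
      2 * (A + G + A)        ≡⟨ cong (2 *_) (F[n+2] i) ⟨
      2 * B                  ∎)) (cong₂ ℤ._-_ (ℤ.pos-* 2 B) (ℤ.pos-* 5 A))
      where
      open ≡-Reasoning
      regroup : ∀ a b → a + 5 * (b + a + b) ≡ 2 * (b + a + b + (b + a) + (b + a + b))
      regroup = solve-∀
    z≡ : ∀ {z} → z + 6 * G ≡ 5 * A → + z ≡ + 17 ℤ.* + A ℤ.- + 6 ℤ.* + B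
    z≡ {z} z+6G≡5A = trans (x+y≡z⇒x≡z-y (begin
      z + 6 * B                  ≡⟨ cong (λ e → z + 6 * e) (F[n+2] i) ⟩
      z + 6 * (A + G + A)        ≡⟨ regroup₁ z G A ⟩
      z + 6 * G + 12 * A         ≡⟨ cong (_+ 12 * A) z+6G≡5A ⟩
      5 * A + 12 * A             ≡⟨ *-distribʳ-+ A 5 12 ⟨
      17 * A                     ∎)) (cong₂ ℤ._-_ (ℤ.pos-* 17 A) (ℤ.pos-* 6 B))
      where
      open ≡-Reasoning
      regroup₁ : ∀ z g a → z + 6 * (a + g + a) ≡ z + 6 * g + 12 * a
      regroup₁ = solve-∀
    -- The constants 170, 24 and 125 come from 2 H Z = 2 (2 B - 5 A)(17 A - 6 B); the mixed term
    -- -128 A B combines with the 3 A B of the other summands.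
    simplify : ∀ a b →
      a ℤ.* b ℤ.- a ℤ.- b ℤ.+ + 1 ℤ.+ + 2 ℤ.* (b ℤ.* a)
        ℤ.- (+ 2 ℤ.* b ℤ.- + 5 ℤ.* a) ℤ.* (+ 2 ℤ.* (+ 17 ℤ.* a ℤ.- + 6 ℤ.* b))
      ≡ (+ 170 ℤ.* a ℤ.- + 1) ℤ.* a ℤ.+ (+ 24 ℤ.* b ℤ.- + 125 ℤ.* a ℤ.- + 1) ℤ.* b ℤ.+ + 1
    simplify = solve-∀ℤ
    evaluate : (∃ λ z → z + 6 * G ≡ 5 * A × Counted A B (F (2 * i ∸ 1)) a A z) → _
    evaluate (z , z+6G≡5A , counted) =
      counted⇒≐ counted h≡ refl (cong (+ 2 ℤ.*_) (z≡ {z} z+6G≡5A)) (simplify (+ A) (+ B))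

  case-f-quotient : ∀ {i l m r} → 3 ≤ i → 2 ≤ r → F i ≡ m + r * F (2 + l) → m ≤ F (2 + l) →
    n[ 2 ] (F i ∷ F (i + 2) ∷ F (i + (2 + l)) ∷ [])
      ≐ ((+ F i ℤ.+ + 4 ℤ.* + F (2 + l) ℤ.- + 1) ℤ.* + F (i + 2) ℤ.- + F i ℤ.+ + 1) ℚ./ 2
        ℚ.- ((+ 2 ℤ.* + r ℤ.* + F i ℤ.- (+ r ℤ.+ + 3) ℤ.* (+ r ℤ.- + 2) ℤ.* + F (2 + l))
              ℤ.* + F l) ℚ./ 2
  case-f-quotient {i} {l} {m} {suc (suc r)} i≥3 (s≤s (s≤s _)) A≡ m≤G =
    evaluate (Third.counted-2G≤A (admissible {i} l i≥3 refl) r A≡ m≤G)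
    where
    A B G H n : ℕ
    A = F i
    B = F (i + 2)
    G = F (2 + l)
    H = F l
    n = m + r * G
    minuend subtrahend : ℤ
    minuend = (+ A ℤ.+ + 4 ℤ.* + G ℤ.- + 1) ℤ.* + B ℤ.- + A ℤ.+ + 1
    subtrahend = (+ 2 ℤ.* + (2 + r) ℤ.* + A ℤ.- (+ (2 + r) ℤ.+ + 3) ℤ.* (+ (2 + r) ℤ.- + 2) ℤ.* + G) ℤ.* + H
    n≡ : + n ≡ + A ℤ.- + 2 ℤ.* + G
    n≡ = trans (x+y≡z⇒x≡z-y {y = 2 * G} (trans (regroup m r G) (sym A≡))) (cong (λ e → + A ℤ.- e) (ℤ.pos-* 2 G))
      where
      regroup : ∀ m r g → m + r * g + 2 * g ≡ m + (2 + r) * g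
      regroup = solve-∀
    2z-in-ℤ : ∀ {z} → 2 * z + G * (r * suc r) ≡ 4 * A + 2 * (r * n) →
      + 2 ℤ.* + z ≡ + 4 ℤ.* + A ℤ.+ + 2 ℤ.* (+ r ℤ.* (+ A ℤ.- + 2 ℤ.* + G)) ℤ.- + G ℤ.* (+ r ℤ.* (+ 1 ℤ.+ + r))
    2z-in-ℤ {z} 2z≡ = begin
      + 2 ℤ.* + z
        ≡⟨ ℤ.pos-* 2 z ⟨
      + (2 * z)
        ≡⟨ x+y≡z⇒x≡z-y 2z≡ ⟩
      + (4 * A + 2 * (r * n)) ℤ.- + (G * (r * suc r))
        ≡⟨ cong₂ ℤ._-_
             (cong₂ ℤ._+_ (ℤ.pos-* 4 A)
               (trans (ℤ.pos-* 2 (r * n)) (cong (+ 2 ℤ.*_) (trans (ℤ.pos-* r n) (cong (+ r ℤ.*_) n≡)))))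
             (trans (ℤ.pos-* G (r * suc r)) (cong (+ G ℤ.*_) (ℤ.pos-* r (suc r)))) ⟩
      + 4 ℤ.* + A ℤ.+ + 2 ℤ.* (+ r ℤ.* (+ A ℤ.- + 2 ℤ.* + G)) ℤ.- + G ℤ.* (+ r ℤ.* (+ 1 ℤ.+ + r)) ∎
      where open ≡-Reasoning
    -- Here r is the quotient minus 2, so r (r + 5), the coefficient of -g in 2 z, is the product (r
    -- + 3)(r - 2) of the theorem.
    simplify : ∀ a b g h r →
      a ℤ.* b ℤ.- a ℤ.- b ℤ.+ + 1 ℤ.+ + 2 ℤ.* (b ℤ.* (+ 2 ℤ.* g))
        ℤ.- h ℤ.* (+ 4 ℤ.* a ℤ.+ + 2 ℤ.* (r ℤ.* (a ℤ.- + 2 ℤ.* g)) ℤ.- g ℤ.* (r ℤ.* (+ 1 ℤ.+ r)))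
      ≡ ((a ℤ.+ + 4 ℤ.* g ℤ.- + 1) ℤ.* b ℤ.- a ℤ.+ + 1)
        ℤ.- (+ 2 ℤ.* (+ 2 ℤ.+ r) ℤ.* a ℤ.- (+ 2 ℤ.+ r ℤ.+ + 3) ℤ.* (+ 2 ℤ.+ r ℤ.- + 2) ℤ.* g) ℤ.* h
    simplify = solve-∀ℤ
    evaluate : (∃ λ z → 2 * z + G * (r * suc r) ≡ 4 * A + 2 * (r * n) × Counted A B (F (i + (2 + l))) H (2 * G) z) → _
    evaluate (z , 2z≡ , counted) =
      subst (n[ 2 ] (A ∷ B ∷ F (i + (2 + l)) ∷ []) ≐_) (/2-distrib-- minuend subtrahend)
        (counted⇒≐ counted refl (ℤ.pos-* 2 G) (2z-in-ℤ {z} 2z≡) (simplify (+ A) (+ B) (+ G) (+ H) (+ r)))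

  F>0 : ∀ n → 0 < F (suc n)
  F>0 n = >-nonZero⁻¹ (F (suc n)) {{F-nonZero {suc n} (s≤s z≤n)}}

  -- If k ≥ i - 1, then F i - 1 < F (i - 1) + F (i - 2) ≤ 2 F k, so the quotient is below 2.
  2≤quotient⇒k≤i∸2 : ∀ {i k} → .{{_ : NonZero (F k)}} → 3 ≤ i → 2 ≤ (F i ∸ 1) / F k → k ≤ i ∸ 2
  2≤quotient⇒k≤i∸2 {suc (suc l)} {k} (s≤s (s≤s _)) 2≤r = ≮⇒≥ λ l<k → contradiction
    (<-≤-trans (m<n*o⇒m/o<n (A-1<2G l<k)) 2≤r) (<-irrefl refl)
    where
    open ≤-Reasoning
    A-1<2G : l < k → F (2 + l) ∸ 1 < 2 * F k
    A-1<2G l<k = begin-strict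
      F (2 + l) ∸ 1          <⟨ ∸-monoʳ-< {F (2 + l)} z<s (F>0 (suc l)) ⟩
      F (suc l) + F l        ≤⟨ +-monoʳ-≤ (F (suc l)) (F-≤-suc l) ⟩
      F (suc l) + F (suc l)  ≤⟨ +-mono-≤ (F-mono-≤ l<k) (F-mono-≤ l<k) ⟩
      F k + F k              ≡⟨ cong (λ e → F k + e) (+-identityʳ (F k)) ⟨
      2 * F k                ∎

  -- With l = i - 2, F i = 2 F l + F (l - 1) strictly exceeds 2 F l ≥ 2 F k; strictness pays for the
  -- 1 subtracted from F i.
  k≤i∸2⇒2≤quotient : ∀ {i k} → .{{_ : NonZero (F k)}} → 3 ≤ k → k ≤ i ∸ 2 → 2 ≤ (F i ∸ 1) / F k
  k≤i∸2⇒2≤quotient {0}     k≥3 k≤0 = contradiction (≤-trans k≥3 k≤0) λ ()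
  k≤i∸2⇒2≤quotient {1}     k≥3 k≤0 = contradiction (≤-trans k≥3 k≤0) λ ()
  k≤i∸2⇒2≤quotient {2}     k≥3 k≤0 = contradiction (≤-trans k≥3 k≤0) λ ()
  k≤i∸2⇒2≤quotient {3}     k≥3 k≤1 = contradiction (≤-trans k≥3 k≤1) λ { (s≤s ()) }
  k≤i∸2⇒2≤quotient {suc (suc l@(suc (suc p)))} {k} k≥3 k≤l =
    subst (_≤ (F (4 + p) ∸ 1) / F k) (m*n/n≡m 2 (F k)) (/-monoˡ-≤ (F k) (<⇒≤pred (begin-strict
      2 * F k                                    ≡⟨ cong (λ e → F k + e) (+-identityʳ (F k)) ⟩
      F k + F k                                  ≤⟨ +-mono-≤ (F-mono-≤ k≤l) (F-mono-≤ k≤l) ⟩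
      F l + F l                                  <⟨ +-monoˡ-< (F l) (m<m+n (F l) (F>0 p)) ⟩
      F (2 + l)                                  ∎)))
    where open ≤-Reasoning

  r≥2⇔k≤i∸2 : ∀ {i k} → 3 ≤ i → (k≥3 : 3 ≤ k) →
    2 ≤ _/_ (F i ∸ 1) (F k) {{F-nonZero (≤-trans (s≤s z≤n) k≥3)}} ⇔ k ≤ i ∸ 2
  r≥2⇔k≤i∸2 {i} {k} i≥3 k≥3 =
    mk⇔ (2≤quotient⇒k≤i∸2 {i} {k} {{Fk≢0}} i≥3) (k≤i∸2⇒2≤quotient {i} {k} {{Fk≢0}} k≥3)
    where
    Fk≢0 : NonZero (F k)
    Fk≢0 = F-nonZero (≤-trans (s≤s z≤n) k≥3)

  case-f : ∀ {i k} → 3 ≤ i → (k≥3 : 3 ≤ k) →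
    let r = _/_ (F i ∸ 1) (F k) {{F-nonZero (≤-trans (s≤s z≤n) k≥3)}} in
    2 ≤ r →
    n[ 2 ] (F i ∷ F (i + 2) ∷ F (i + k) ∷ [])
      ≐ ((+ F i ℤ.+ + 4 ℤ.* + F k ℤ.- + 1) ℤ.* + F (i + 2) ℤ.- + F i ℤ.+ + 1) ℚ./ 2
        ℚ.- ((+ 2 ℤ.* + r ℤ.* + F i ℤ.- (+ r ℤ.+ + 3) ℤ.* (+ r ℤ.- + 2) ℤ.* + F k) ℤ.* + F (k ∸ 2)) ℚ./ 2
  case-f {i} {k@(suc (suc l))} i≥3 (s≤s (s≤s _)) r≥2 =
    -- Dividing F i - 1 instead of F i gives F i = m + r F k with 1 ≤ m ≤ F k, where m is one more
    -- than the remainder.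
    case-f-quotient i≥3 r≥2 (begin
      F i                                                     ≡⟨ suc-pred (F i) ⟨
      suc (F i ∸ 1)                                           ≡⟨ cong suc (m≡m%n+[m/n]*n (F i ∸ 1) (F k)) ⟩
      suc ((F i ∸ 1) % F k) + (F i ∸ 1) / F k * F k           ∎)
      (m%n<n (F i ∸ 1) (F k))
    where
    open ≡-Reasoning
    instance
      Fi≢0 : NonZero (F i)
      Fi≢0 = F-nonZero (≤-trans (s≤s z≤n) i≥3)
      Fk≢0 : NonZero (F k)
      Fk≢0 = F-nonZero {k} (s≤s z≤n)

open import Data.Integer.Base using (+_; _+_; _*_; _-_)
open import Data.Nat.Base as ℕ using (ℕ; _≤_; _≥_; _∸_; s≤s; z≤n)
open import Data.Nat.Properties using (≤-trans)
open import Data.Product.Base using (_×_; _,_)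
open import Data.Rational.Base as ℚ using (_/_)
open import Data.Vec.Base using ([]; _∷_)
open import Function.Bundles using (_⇔_)

theorem11 : ∀ (i k : ℕ) → i ≥ 3 → (k≥3 : k ≥ 3) →
  let A = + F i
      B = + F (i ℕ.+ 2)
      G = + F k
      r = ℕ._/_ (F i ∸ 1) (F k) {{F-nonZero (≤-trans (s≤s z≤n) k≥3)}}
  in
  (k ≥ i ℕ.+ 3 →
    n[ 2 ] (F i ∷ F (i ℕ.+ 2) ∷ F (i ℕ.+ k) ∷ [])
      ≐ (+ 5 * A * B - A - B + + 1) / 2)
  × (n[ 2 ] (F i ∷ F (i ℕ.+ 2) ∷ F (2 ℕ.* i ℕ.+ 2) ∷ [])
      ≐ ((+ 7 * B - + 6 * A - + 1) * A - B + + 1) / 2)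
  × (n[ 2 ] (F i ∷ F (i ℕ.+ 2) ∷ F (2 ℕ.* i ℕ.+ 1) ∷ [])
      ≐ ((+ 7 * B - + 8 * A - + 1) * A - B + + 1) / 2)
  × (n[ 2 ] (F i ∷ F (i ℕ.+ 2) ∷ F (2 ℕ.* i) ∷ [])
      ≐ (+ 3 * A * B - A - B + + 1) / 2)
  × (n[ 2 ] (F i ∷ F (i ℕ.+ 2) ∷ F (2 ℕ.* i ∸ 1) ∷ [])
      ≐ ((+ 170 * A - + 1) * A + (+ 24 * B - + 125 * A - + 1) * B + + 1) / 2)
  × ((r ≥ 2 ⇔ k ≤ i ∸ 2)
    × (r ≥ 2 →
      n[ 2 ] (F i ∷ F (i ℕ.+ 2) ∷ F (i ℕ.+ k) ∷ [])
        ≐ ((A + + 4 * G - + 1) * B - A + + 1) / 2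
          ℚ.- ((+ 2 * + r * A - (+ r + + 3) * (+ r - + 2) * G) * + F (k ∸ 2)) / 2))
theorem11 i k i≥3 k≥3 =
  Proof.case-a i≥3 , Proof.case-b i≥3 , Proof.case-c i≥3 , Proof.case-d i≥3 , Proof.case-e i≥3 ,
  Proof.r≥2⇔k≤i∸2 i≥3 k≥3 , Proof.case-f i≥3 k≥3
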